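{- Let $\ell>2$, let $\lambda$ be an $(\ell,0)$-JM partition and $0\le i<\ell$. Put $\widehat\varphi=\max\{n:\widehat f_i^n\lambda\ne0\}$ and $\widehat\varepsilon=\max\{n:\widehat e_i^n\lambda\ne0\}$. Then: (1) $\widehat f_i^{\widehat\varphi}\lambda$ is an $(\ell,0)$-JM partition; (2) $\widehat e_i^{\widehat\varepsilon}\lambda$ is an $(\ell,0)$-JM partition; (3) $\widehat f_i^{k}\lambda$ is not an $(\ell,0)$-JM partition for $0<k<\widehat\varphi-1$; (4) $\widehat e_i^{k}\lambda$ is not an $(\ell,0)$-JM partition for $1<k<\widehat\varepsilon$.
   Context: Partitions are identified with Young diagrams; $(x,y)$ is the box in row $x$, column $y$, with residue $y-x\bmod\ell$. The hook length $h^\lambda_{(a,c)}$ of a box is the number of boxes of $\lambda$ to its right in its row or below it in its column, including itself. $\lambda$ is an $(\ell,0)$-JM partition if there do NOT exist boxes $(a,b),(a,y),(x,b)$ in $\lambda$ with $\ell\mid h^\lambda_{(a,b)}$, $\ell\nmid h^\lambda_{(a,y)}$, $\ell\nmid h^\lambda_{(x,b)}$. Ladder crystal operators: for residue $i$, mark removable boxes of residue $i$ by $-$ and addable positions of residue $i$ by $+$; read them ordering positions $(x,y)$ by ladder number $x+(\ell-1)(y-1)$ increasing and, within a ladder, top to bottom; successively cancel adjacent pairs $-+$. Then $\widehat e_i\lambda$ removes the box of the leftmost remaining $-$ and $\widehat f_i\lambda$ adds the box of the rightmost remaining $+$ (each is $0$ if no such sign exists; $\widehat e_i0=\widehat f_i0=0$).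 -}

module Defs where

open import Data.Nat using (ℕ; zero; suc; _+_; _*_; _∸_; _≤_; _<_; _≡ᵇ_; _<ᵇ_; _≤ᵇ_; _%_)
open import Data.Nat.Divisibility using (_∣_)
open import Data.Bool using (Bool; true; false; if_then_else_; _∧_; _∨_; not)
open import Data.List using (List; []; _∷_; _++_; length; filter; map; reverse; upTo)
open import Data.List.Relation.Unary.All using (All)
open import Data.List.Relation.Unary.Linked using (Linked)
open import Data.Maybe using (Maybe; just; nothing)
open import Data.Product using (_×_; _,_; ∃)
open import Relation.Nullary using (¬_)
open import Relation.Binary.PropositionalEquality using (_≡_)
open import Function using (_∘_)

-- Partitions: lists of positive rows, weakly decreasing.
-- Row x (1-indexed) has length (row p x); rows beyond the list are 0.

IsPartition : List ℕ → Set
IsPartition p = All (0 <_) p × Linked (λ a b → b ≤ a) p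

row : List ℕ → ℕ → ℕ
row []       _             = 0
row (_ ∷ _)  zero          = 0
row (r ∷ _)  (suc zero)    = r
row (_ ∷ rs) (suc (suc a)) = row rs (suc a)

colLen : List ℕ → ℕ → ℕ
colLen p b = length (filter (λ r → Data.Nat._≤?_ b r) p)

Box : List ℕ → ℕ → ℕ → Set
Box p a b = 1 ≤ a × 1 ≤ b × b ≤ row p a

hook : List ℕ → ℕ → ℕ → ℕ
hook p a b = (row p a ∸ b) + (colLen p b ∸ a) + 1

JM : ℕ → List ℕ → Set
JM ℓ p = ¬ (∃ λ a → ∃ λ b → ∃ λ x → ∃ λ y →
             Box p a b × Box p a y × Box p x b ×
             ℓ ∣ hook p a b × ¬ (ℓ ∣ hook p a y) × ¬ (ℓ ∣ hook p x b))

-- residue of (x , y) is (y - x) mod ℓ, computed as (y + (ℓ-1) x) mod ℓ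
res : ℕ → ℕ → ℕ → ℕ
res zero    x y = 0
res (suc k) x y = (y + k * x) % suc k

ladder : ℕ → ℕ → ℕ → ℕ
ladder ℓ x y = x + (ℓ ∸ 1) * (y ∸ 1)

rows1 : List ℕ → List ℕ
rows1 p = map suc (upTo (suc (length p)))

isAddable : List ℕ → ℕ → Bool
isAddable p zero          = false
isAddable p (suc zero)    = true
isAddable p (suc (suc x)) = row p (suc (suc x)) <ᵇ row p (suc x)

isRemovable : List ℕ → ℕ → Bool
isRemovable p x = (1 ≤ᵇ x) ∧ (row p (suc x) <ᵇ row p x)

data Sign : Set where
  plus minus : Sign

Entry : Set
Entry = Sign × ℕ × ℕ

addables : ℕ → ℕ → List ℕ → List Entry
addables ℓ i p = Data.List.mapMaybe
  (λ x → if isAddable p x ∧ (res ℓ x (suc (row p x)) ≡ᵇ i)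
         then just (plus , x , suc (row p x)) else nothing) (rows1 p)

removables : ℕ → ℕ → List ℕ → List Entry
removables ℓ i p = Data.List.mapMaybe
  (λ x → if isRemovable p x ∧ (res ℓ x (row p x) ≡ᵇ i)
         then just (minus , x , row p x) else nothing) (rows1 p)

before : ℕ → Entry → Entry → Bool
before ℓ (_ , x , y) (_ , x' , y') =
  (ladder ℓ x y <ᵇ ladder ℓ x' y') ∨
  ((ladder ℓ x y ≡ᵇ ladder ℓ x' y') ∧ (x ≤ᵇ x'))

insert : ℕ → Entry → List Entry → List Entry
insert ℓ e []       = e ∷ []
insert ℓ e (d ∷ ds) = if before ℓ e d then e ∷ d ∷ ds else d ∷ insert ℓ e ds

sortEntries : ℕ → List Entry → List Entry
sortEntries ℓ []       = []
sortEntries ℓ (e ∷ es) = insert ℓ e (sortEntries ℓ es)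

signature : ℕ → ℕ → List ℕ → List Entry
signature ℓ i p = sortEntries ℓ (addables ℓ i p ++ removables ℓ i p)

-- successive cancellation of adjacent pairs  - +  (stack-based; the
-- stack holds the reduced prefix in reverse order)
cancelStep : List Entry → Entry → List Entry
cancelStep ((minus , q) ∷ st) (plus , r) = st
cancelStep st e = e ∷ st

cancelAux : List Entry → List Entry → List Entry
cancelAux st []       = reverse st
cancelAux st (e ∷ es) = cancelAux (cancelStep st e) es

reduced : ℕ → ℕ → List ℕ → List Entry
reduced ℓ i p = cancelAux [] (signature ℓ i p)

firstMinus : List Entry → Maybe ℕ
firstMinus []                    = nothing
firstMinus ((minus , x , _) ∷ _) = just x
firstMinus ((plus , _) ∷ es)     = firstMinus es

firstPlus : List Entry → Maybe ℕ
firstPlus []                   = nothing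
firstPlus ((plus , x , _) ∷ _) = just x
firstPlus ((minus , _) ∷ es)   = firstPlus es

addBox : ℕ → List ℕ → List ℕ
addBox zero          p        = p
addBox (suc zero)    []       = 1 ∷ []
addBox (suc zero)    (r ∷ rs) = suc r ∷ rs
addBox (suc (suc x)) []       = []
addBox (suc (suc x)) (r ∷ rs) = r ∷ addBox (suc x) rs

removeBox : ℕ → List ℕ → List ℕ
removeBox zero          p              = p
removeBox (suc zero)    []             = []
removeBox (suc zero)    (suc zero ∷ rs) = rs
removeBox (suc zero)    (r ∷ rs)       = (r ∸ 1) ∷ rs
removeBox (suc (suc x)) []             = []
removeBox (suc (suc x)) (r ∷ rs)       = r ∷ removeBox (suc x) rs

-- ladder crystal operators; nothing plays the role of 0
eHat : ℕ → ℕ → Maybe (List ℕ) → Maybe (List ℕ)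
eHat ℓ i nothing  = nothing
eHat ℓ i (just p) with firstMinus (reduced ℓ i p)
... | nothing = nothing
... | just x  = just (removeBox x p)

fHat : ℕ → ℕ → Maybe (List ℕ) → Maybe (List ℕ)
fHat ℓ i nothing  = nothing
fHat ℓ i (just p) with firstPlus (reverse (reduced ℓ i p))
... | nothing = nothing
... | just x  = just (addBox x p)

iter : ℕ → (Maybe (List ℕ) → Maybe (List ℕ)) → Maybe (List ℕ) → Maybe (List ℕ)
iter zero    g m = m
iter (suc n) g m = g (iter n g m)

IsMaxNonzero : (Maybe (List ℕ) → Maybe (List ℕ)) → List ℕ → ℕ → Set
IsMaxNonzero g p n =
  ¬ (iter n g (just p) ≡ nothing) × (∀ k → ¬ (iter k g (just p) ≡ nothing) → k ≤ n)

{-# OPTIONS --safe #-}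
module Submission where

-- Read a partition as a bead configuration on an abacus with ℓ runners, so that hooks are pairs of a
-- gap below a bead and a hook is divisible by ℓ iff both lie on one runner. A box of residue i is a
-- bead moving between runners 0 and 1 at some level: a level with a bead only on 0 is a +, one with a
-- bead only on 1 is a −.
--
-- Two +'s and one − already contain a violation of the JM condition. This gives (3) and (4), since an
-- intermediate iterate has a further two steps to go (or behind it) and one step on the other side.
--
-- In a JM partition every + precedes every −: otherwise a whole stretch of a row or a column consists
-- of hooks divisible by ℓ, and its length contradicts the ladder order (here ℓ > 2 is used). So nothing
-- cancels, neither in the partition nor along its string, and the last iterate under f̂ (under ê) has
-- no + (no −) left. A violation in such an end of the string, where one of runners 0 and 1 contains the
-- other, can be traced back to any abacus with the same number of beads on runners 0 and 1 at each
-- level; hence the ends of the string of a JM partition are JM, which is (1) and (2).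

open import Defs
open import Data.Nat
open import Data.Nat.Properties
open import Data.Nat.Divisibility
open import Data.Nat.DivMod hiding (_div_)
open import Data.Nat.Tactic.RingSolver using (solve-∀)
open import Data.Bool using (Bool; true; false; not; _∧_; if_then_else_)
open import Data.Bool.Properties using (T-≡; ∧-conicalˡ; ∧-conicalʳ; not-¬; ¬-not)
open import Data.Empty using (⊥; ⊥-elim)
open import Data.List using (List; []; _∷_; [_]; _++_; length; mapMaybe; reverse)
open import Data.List.Properties
  using (length-filter; filter-accept; filter-reject; unfold-reverse; ++-assoc; ++-identityʳ)
open import Data.List.Membership.Propositional using (_∈_; _∉_)
open import Data.List.Membership.Propositional.Properties
  using (∈-map⁺; ∈-upTo⁺; ∈-++⁺ˡ; ∈-++⁺ʳ; ∈-++⁻)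
open import Data.List.Relation.Binary.Permutation.Propositional using (_↭_; ↭-refl; ↭-sym; ↭-trans; prep; swap)
open import Data.List.Relation.Binary.Permutation.Propositional.Properties using (All-resp-↭; ∈-resp-↭; ↭-reverse)
open import Data.List.Relation.Unary.All as All using (All; []; _∷_)
open import Data.List.Relation.Unary.AllPairs using (AllPairs; []; _∷_)
import Data.List.Relation.Unary.AllPairs.Properties as AllPairs
open import Data.List.Relation.Unary.Any using (here; there)
open import Data.List.Relation.Unary.Linked using (Linked; []; [-]; _∷_)
open import Data.Maybe using (Maybe; just; nothing)
open import Data.Maybe.Properties using (just-injective)
open import Data.Product using (_×_; _,_; ∃; proj₁; proj₂)
open import Data.Sum using (_⊎_; inj₁; inj₂)
open import Function using (flip)
open import Function.Bundles using (Equivalence)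
open import Relation.Binary.Definitions using (tri<; tri≈; tri>)
open import Relation.Binary.PropositionalEquality hiding ([_])
open import Relation.Nullary using (¬_; Dec; yes; no; does)
open import Relation.Nullary.Decidable using (decidable-stable)

private variable
  p p′ p⁺ μ : List ℕ
  a b x L q g : ℕ
  A : Set

-- Young diagrams and Maya diagrams

tail-partition : ∀ {r rs} → IsPartition (r ∷ rs) → IsPartition rs
tail-partition (_ ∷ pos , [-])     = pos , []
tail-partition (_ ∷ pos , _ ∷ dec) = pos , dec

row-step : IsPartition p → ∀ a → row p (suc (suc a)) ≤ row p (suc a)
row-step {[]}         _             a       = z≤n
row-step {_ ∷ []}     _             zero    = z≤n
row-step {_ ∷ []}     _             (suc a) = z≤n
row-step {_ ∷ _ ∷ _}  (_ , s≤r ∷ _) zero    = s≤r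
row-step {_ ∷ _ ∷ _}  P             (suc a) = row-step (tail-partition P) a

row-antitone : IsPartition p → 1 ≤ a → a ≤ b → row p b ≤ row p a
row-antitone {p} {suc a} {b} P _ a≤b = subst (λ n → row p n ≤ row p (suc a)) (m+[n∸m]≡n a≤b) (go (b ∸ suc a))
  where
  go : ∀ n → row p (suc a + n) ≤ row p (suc a)
  go zero    rewrite +-identityʳ a = ≤-refl
  go (suc n) rewrite +-suc a n = ≤-trans (row-step P (a + n)) (go n)

row-beyond : ∀ p → length p < a → row p a ≡ 0
row-beyond []       _         = refl
row-beyond {suc zero}    (r ∷ p) (s≤s ())
row-beyond {suc (suc a)} (r ∷ p) (s≤s lt) = row-beyond p lt

colLen≤length : ∀ p b → colLen p b ≤ length p
colLen≤length p b = length-filter (b ≤?_) p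

colLen-accept : ∀ {r} rs → b ≤ r → colLen (r ∷ rs) b ≡ suc (colLen rs b)
colLen-accept {b} rs b≤r = cong length (filter-accept (b ≤?_) {xs = rs} b≤r)

colLen-reject : ∀ {r} rs → ¬ (b ≤ r) → colLen (r ∷ rs) b ≡ colLen rs b
colLen-reject {b} rs b≰r = cong length (filter-reject (b ≤?_) {xs = rs} b≰r)

row⇒col : IsPartition p → 1 ≤ a → 1 ≤ b → b ≤ row p a → a ≤ colLen p b
row⇒col {[]} _ _ 1≤b b≤0 = ⊥-elim (<⇒≱ 1≤b b≤0)
row⇒col {r ∷ rs} {suc zero} P _ 1≤b b≤r = subst (1 ≤_) (sym (colLen-accept rs b≤r)) (s≤s z≤n)
row⇒col {r ∷ rs} {suc (suc a)} P _ 1≤b b≤row =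
  subst (suc (suc a) ≤_) (sym (colLen-accept rs (≤-trans b≤row (row-antitone {a = 1} {b = suc (suc a)} P (s≤s z≤n) (s≤s z≤n)))))
    (s≤s (row⇒col (tail-partition P) (s≤s z≤n) 1≤b b≤row))

col⇒row : IsPartition p → 1 ≤ a → a ≤ colLen p b → b ≤ row p a
col⇒row {[]} _ 1≤a a≤0 = ⊥-elim (<⇒≱ 1≤a a≤0)
col⇒row {r ∷ rs} {suc a} {b} P 1≤a a≤c with b ≤? r
col⇒row {r ∷ rs} {suc zero}    P _ a≤c | yes b≤r = b≤r
col⇒row {r ∷ rs} {suc (suc a)} P _ a≤c | yes b≤r =
  col⇒row (tail-partition P) (s≤s z≤n) (≤-pred (subst (suc (suc a) ≤_) (colLen-accept rs b≤r) a≤c))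
... | no b≰r = ⊥-elim (b≰r (≤-trans (col⇒row (tail-partition P) ≤-refl (≤-trans 1≤a (subst (suc a ≤_) (colLen-reject rs b≰r) a≤c)))
                                    (row-antitone {a = 1} {b = 2} P ≤-refl (s≤s z≤n))))

row<⇒colLen< : IsPartition p → 1 ≤ a → row p a < b → colLen p b < a
row<⇒colLen< P 1≤a r<b = ≰⇒> λ a≤c → <⇒≱ r<b (col⇒row P 1≤a a≤c)

-- The convention `row p 0` = 0 would falsify the lower bound for a = 0, so that bound is asked for
-- only when `1 ≤ a`.
colLen-unique : IsPartition p → 1 ≤ b → (1 ≤ a → b ≤ row p a) → row p (suc a) < b → colLen p b ≡ a
colLen-unique {a = zero}  P 1≤b _  lt = n<1⇒n≡0 (row<⇒colLen< P (s≤s z≤n) lt)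
colLen-unique {a = suc a} P 1≤b le lt =
  ≤-antisym (≤-pred (row<⇒colLen< P (s≤s z≤n) lt)) (row⇒col P (s≤s z≤n) 1≤b (le (s≤s z≤n)))

-- The Maya diagram of p moved up by L: row a is a bead at row p a − a + L and column b is a gap at
-- b − 1 − colLen p b + L, with terms moved across so that no subtraction is truncated.
record BeadAt (L : ℕ) (p : List ℕ) (q a : ℕ) : Set where
  constructor beadAt
  field bead-eq : q + a ≡ row p a + L

record GapAt (L : ℕ) (p : List ℕ) (g b : ℕ) : Set where
  constructor gapAt
  field gap-eq : g + suc (colLen p b) ≡ b + L

open BeadAt
open GapAt

-- A column beyond the end of row a is shorter than a, so its gap would lie above the bead.
bead>gap⇒box : IsPartition p → 1 ≤ a → BeadAt L p q a → GapAt L p g b → g < q → b ≤ row p a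
bead>gap⇒box {p} {a} {L} {q} {g} {b} P 1≤a bq gg g<q = ≮⇒≥ λ r<b → <-irrefl refl (begin-strict
  q + a                ≡⟨ bead-eq bq ⟩
  row p a + L          <⟨ +-monoˡ-< L r<b ⟩
  b + L                ≡⟨ gap-eq gg ⟨
  g + suc (colLen p b) ≤⟨ +-monoʳ-≤ g (row<⇒colLen< P 1≤a r<b) ⟩
  g + a                <⟨ +-monoˡ-< a g<q ⟩
  q + a                ∎)
  where open ≤-Reasoning

-- With the row written as arm + b and the column as leg + a, this is a linear identity in which L
-- cancels.
box⇒hook : IsPartition p → 1 ≤ a → 1 ≤ b → BeadAt L p q a → GapAt L p g b → b ≤ row p a →
           q ≡ g + hook p a b
box⇒hook {p} {a} {b} {L} {q} {g} P 1≤a 1≤b bq gg b≤r = +-cancelʳ-≡ (a + (b + L)) q _ (begin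
  q + (a + (b + L))                  ≡⟨ +-assoc q a _ ⟨
  q + a + (b + L)                    ≡⟨ cong₂ _+_ (bead-eq bq) (sym (gap-eq gg)) ⟩
  row p a + L + (g + suc c)          ≡⟨ cong₂ (λ s t → s + L + (g + suc t)) (sym (m∸n+n≡m b≤r)) (sym (m∸n+n≡m a≤c)) ⟩
  u + b + L + (g + suc (v + a))      ≡⟨ shuffle u b L g v a ⟩
  g + (u + v + 1) + (a + (b + L))    ∎)
  where
  open ≡-Reasoning
  c = colLen p b
  a≤c = row⇒col P 1≤a 1≤b b≤r
  u = row p a ∸ b
  v = c ∸ a
  shuffle : ∀ u b L g v a → u + b + L + (g + suc (v + a)) ≡ g + (u + v + 1) + (a + (b + L))
  shuffle = solve-∀

hook-positive : ∀ p a b → 0 < hook p a b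
hook-positive p a b = subst (0 <_) (+-comm 1 _) (s≤s z≤n)

box⇒gap<bead : IsPartition p → 1 ≤ a → 1 ≤ b → BeadAt L p q a → GapAt L p g b → b ≤ row p a → g < q
box⇒gap<bead {p} {a} {b} {g = g} P 1≤a 1≤b bq gg b≤r =
  subst (g <_) (sym (box⇒hook P 1≤a 1≤b bq gg b≤r)) (m<m+n g (hook-positive p a b))

-- If (a , b) is a box, a shared position would make its hook length 0; otherwise the gap lies
-- strictly above the bead.
bead≢gap : IsPartition p → 1 ≤ a → 1 ≤ b → BeadAt L p q a → ¬ GapAt L p q b
bead≢gap {p} {a} {b} {L} {q} P 1≤a 1≤b bq gq with b ≤? row p a
... | yes b≤r = <-irrefl refl (box⇒gap<bead P 1≤a 1≤b bq gq b≤r)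
... | no b≰r = <-irrefl refl (begin-strict
  q + a                ≡⟨ bead-eq bq ⟩
  row p a + L          <⟨ +-monoˡ-< L (≰⇒> b≰r) ⟩
  b + L                ≡⟨ gap-eq gq ⟨
  q + suc (colLen p b) ≤⟨ +-monoʳ-≤ q (row<⇒colLen< P 1≤a (≰⇒> b≰r)) ⟩
  q + a                ∎)
  where open ≤-Reasoning

Bead Gap : ℕ → List ℕ → ℕ → Set
Bead L p q = ∃ λ a → 1 ≤ a × BeadAt L p q a
Gap  L p q = ∃ λ b → 1 ≤ b × GapAt L p q b

-- Search through the rows from row L + 1, which is empty and would sit at -1, up to row 1. The
-- beads rise strictly, so either one of them is at q, or q lies above row n + 1 and, if n > 0,
-- below row n; then q is the gap of a column of length n.
bead⊎gap : IsPartition p → length p < L → ∀ q → Bead L p q ⊎ Gap L p q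
bead⊎gap {p} {L} P n<L q = search L (begin-strict
  row p (suc L) + L ≡⟨ cong (_+ L) (row-beyond p (m<n⇒m<1+n n<L)) ⟩
  L                 <⟨ n<1+n L ⟩
  suc L             ≤⟨ m≤n+m (suc L) q ⟩
  q + suc L         ∎)
  where
  open ≤-Reasoning
  gap-below : ∀ n → row p (suc n) + L < q + suc n → (1 ≤ n → q + n < row p n + L) → Gap L p q
  gap-below n lt ge = col , 1≤col , gapAt (trans (cong (λ c → q + suc c) colLen≡n) (sym col+L))
    where
    col : ℕ
    col = q + suc n ∸ L
    col+L : col + L ≡ q + suc n
    col+L = m∸n+n≡m (≤-trans (m≤n+m L _) (<⇒≤ lt))
    r<col : row p (suc n) < col
    r<col = +-cancelʳ-< L _ col (subst (row p (suc n) + L <_) (sym col+L) lt)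
    1≤col : 1 ≤ col
    1≤col = ≤-trans (s≤s z≤n) r<col
    colLen≡n : colLen p col ≡ n
    colLen≡n = colLen-unique P 1≤col
      (λ 1≤n → +-cancelʳ-≤ L col _ (subst (_≤ row p n + L) (sym (trans col+L (+-suc q n))) (ge 1≤n))) r<col
  search : ∀ n → row p (suc n) + L < q + suc n → Bead L p q ⊎ Gap L p q
  search zero    lt = inj₂ (gap-below 0 lt λ ())
  search (suc n) lt with <-cmp (q + suc n) (row p (suc n) + L)
  ... | tri< lt′ _ _ = inj₂ (gap-below (suc n) lt λ _ → lt′)
  ... | tri≈ _ eq _  = inj₁ (suc n , s≤s z≤n , beadAt eq)
  ... | tri> _ _ gt  = search n gt

bead-of-row : a ≤ L → ∃ λ q → BeadAt L p q a
bead-of-row {a} {L} {p = p} a≤L = row p a + L ∸ a , beadAt (m∸n+n≡m (≤-trans a≤L (m≤n+m L _)))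

gap-of-column : length p < L → ∀ b → ∃ λ g → GapAt L p g b
gap-of-column {p} {L} n<L b = b + L ∸ suc (colLen p b) , gapAt (m∸n+n≡m (≤-trans (s≤s (colLen≤length p b)) (≤-trans n<L (m≤n+m L b))))

bead? : ∀ L p q → Dec (∃ λ a → a < L × q + suc a ≡ row p (suc a) + L)
bead? L p q = anyUpTo? (λ a → q + suc a ≟ row p (suc a) + L) L

-- Rows beyond L are empty and would sit at negative positions, so the bounded search of `bead?`
-- misses no bead.
bead⇒≤ : length p < L → 1 ≤ a → BeadAt L p q a → a ≤ L
bead⇒≤ {p} {L} {a} {q} n<L 1≤a bq with a ≤? L
... | yes a≤L = a≤L
... | no a≰L = ≤-trans (m≤n+m a q) (≤-reflexive (trans (bead-eq bq) (cong (_+ L) (row-beyond p (<-trans n<L (≰⇒> a≰L))))))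

opaque

  maya : ℕ → List ℕ → ℕ → Bool
  maya L p q = does (bead? L p q)

  maya-true : maya L p q ≡ true → Bead L p q
  maya-true {L} {p} {q} eq with bead? L p q
  maya-true eq | yes (a , _ , eq′) = suc a , s≤s z≤n , beadAt eq′

  true-maya : length p < L → 1 ≤ a → BeadAt L p q a → maya L p q ≡ true
  true-maya {p} {L} {suc a} {q} n<L 1≤a bq with bead? L p q
  ... | yes _ = refl
  ... | no none = ⊥-elim (none (a , bead⇒≤ n<L 1≤a bq , bead-eq bq))

  maya-false : IsPartition p → length p < L → maya L p q ≡ false → Gap L p q
  maya-false {p} {L} {q} P n<L eq with bead⊎gap P n<L q
  ... | inj₂ gap = gap
  ... | inj₁ (a , 1≤a , bq) with () ← trans (sym (true-maya n<L 1≤a bq)) eq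

  false-maya : IsPartition p → 1 ≤ b → GapAt L p q b → maya L p q ≡ false
  false-maya {p} {b} {L} {q} P 1≤b gq with bead? L p q
  ... | no _ = refl
  ... | yes (a , _ , eq) = ⊥-elim (bead≢gap P (s≤s z≤n) 1≤b (beadAt {a = suc a} eq) gq)

-- Violations of the JM condition on an abacus

-- Level, then runner; true is a bead and false a gap.
Abacus : Set
Abacus = ℕ → ℕ → Bool

infix 4 _≺_
-- For runners below ℓ this is the order of the positions i + m ℓ.
_≺_ : ℕ × ℕ → ℕ × ℕ → Set
(m , i) ≺ (k , j) = m < k ⊎ (m ≡ k × i < j)

OtherGap OtherBead : ℕ → Abacus → ℕ → ℕ → Set
OtherGap  ℓ W k j = ∃ λ m → ∃ λ i → i < ℓ × i ≢ j × W m i ≡ false × (m , i) ≺ (k , j)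
OtherBead ℓ W k j = ∃ λ n → ∃ λ i → i < ℓ × i ≢ j × W n i ≡ true × (k , j) ≺ (n , i)

-- The abacus form of the three boxes excluded by `JM`: `gap` and `bead` on runner `j` give (a , b),
-- `otherGap` gives (a , y) in the row of the bead, and `otherBead` gives (x , b) in the column of
-- the gap.
record Violation (ℓ : ℕ) (W : Abacus) : Set where
  constructor violation
  field
    {k k′ j}  : ℕ
    k<k′      : k < k′
    j<ℓ       : j < ℓ
    gap       : W k j ≡ false
    bead      : W k′ j ≡ true
    otherGap  : OtherGap ℓ W k′ j
    otherBead : OtherBead ℓ W k j

-- Boxes of residue i live on runners 0 and 1 (this fixes offset below).
runner : Bool → ℕ
runner false = 0
runner true  = 1

runner<2 : ∀ u → runner u < 2
runner<2 false = s≤s z≤n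
runner<2 true  = s≤s (s≤s z≤n)

runner≢ : ∀ u → runner (not u) ≢ runner u
runner≢ false ()
runner≢ true ()

runner≢2+ : ∀ u {i} → 2 + i ≢ runner u
runner≢2+ false ()
runner≢2+ true ()

data Swap01 (W W′ : Abacus) (k : ℕ) : Set where
  kept    : (∀ u → W k (runner u) ≡ W′ k (runner u)) → Swap01 W W′ k
  swapped : (∀ u → W k (runner u) ≡ W′ k (runner (not u))) → Swap01 W W′ k

-- What survives along a whole i-string, since a box of residue i only exchanges runners 0 and 1 at
-- one level.
record Related (ℓ : ℕ) (W W′ : Abacus) : Set where
  field
    outside : ∀ k j → 2 + j < ℓ → W k (2 + j) ≡ W′ k (2 + j)
    inside  : ∀ k → Swap01 W W′ k

Both : Abacus → ℕ → Bool → Set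
Both W k b = ∀ u → W k (runner u) ≡ b

both : ∀ {W k b} s → W k (runner s) ≡ b → W k (runner (not s)) ≡ b → Both W k b
both false ws wt false = ws
both false ws wt true  = wt
both true  ws wt false = wt
both true  ws wt true  = ws

not-both : ∀ {W k} u → Both W k false → W k (runner u) ≢ true
not-both u bo eq with () ← trans (sym (bo u)) eq

data IsRunner : ℕ → Set where
  pair : ∀ u → IsRunner (runner u)
  rest : ∀ j → IsRunner (2 + j)

isRunner : ∀ j → IsRunner j
isRunner 0 = pair false
isRunner 1 = pair true
isRunner (suc (suc j)) = rest j

pair-or-other : ∀ s u → u ≡ s ⊎ u ≡ not s
pair-or-other false false = inj₁ refl
pair-or-other false true  = inj₂ refl
pair-or-other true  false = inj₂ refl
pair-or-other true  true  = inj₁ refl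

≺-below-pair : ∀ {m i k} u → (m , 2 + i) ≺ (k , runner u) → m < k
≺-below-pair u     (inj₁ m<k) = m<k
≺-below-pair false (inj₂ (_ , ()))
≺-below-pair true  (inj₂ (_ , s≤s ()))

≺-above-pair : ∀ {n i k} u v → (k , runner u) ≺ (n , 2 + i) → (k , runner v) ≺ (n , 2 + i)
≺-above-pair u v (inj₁ k<n)       = inj₁ k<n
≺-above-pair u v (inj₂ (k≡n , _)) = inj₂ (k≡n , ≤-trans (runner<2 v) (s≤s (s≤s z≤n)))

module _ {ℓ : ℕ} (2<ℓ : 2 < ℓ) where

  runner<ℓ : ∀ u → runner u < ℓ
  runner<ℓ u = ≤-trans (runner<2 u) (<⇒≤ 2<ℓ)

  -- With the - above both +'s, the divisible hook runs on runner 1 from the lower + to the -. With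
  -- the - below the upper +, it runs on runner 0 from the - to that +. The other one of runners 0
  -- and 1 supplies the two remaining boxes.
  two-pluses-minus⇒violation : ∀ {W u₁ u₂ v} → u₁ < u₂ →
    W u₁ 0 ≡ true → W u₁ 1 ≡ false → W u₂ 0 ≡ true → W u₂ 1 ≡ false →
    W v 0 ≡ false → W v 1 ≡ true → Violation ℓ W
  two-pluses-minus⇒violation {W} {u₁} {u₂} {v} u₁<u₂ b₁ g₁ b₂ g₂ gv bv with <-cmp u₂ v
  ... | tri≈ _ refl _ with () ← trans (sym b₂) gv
  ... | tri< u₂<v _ _ = violation (<-trans u₁<u₂ u₂<v) (runner<ℓ true) g₁ bv
          (v , 0 , runner<ℓ false , (λ ()) , gv , inj₂ (refl , s≤s z≤n))
          (u₂ , 0 , runner<ℓ false , (λ ()) , b₂ , inj₁ u₁<u₂)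
  ... | tri> _ _ v<u₂ = violation v<u₂ (runner<ℓ false) gv b₂
          (u₁ , 1 , runner<ℓ true , (λ ()) , g₁ , inj₁ u₁<u₂)
          (v , 1 , runner<ℓ true , (λ ()) , bv , inj₂ (refl , s≤s z≤n))

  module _ {W W′ : Abacus} (R : Related ℓ W W′) where
    open Related R

    transport-both : ∀ {k b} → Both W′ k b → Both W k b
    transport-both {k} bo u with inside k
    ... | kept eq    = trans (eq u) (bo u)
    ... | swapped eq = trans (eq u) (bo (not u))

    transport-one : ∀ {k b} u → W′ k (runner u) ≡ b → ∃ λ v → W k (runner v) ≡ b
    transport-one {k} u eqb with inside k
    ... | kept eq    = u , trans (eq u) eqb
    transport-one false eqb | swapped eq = true , trans (eq true) eqb
    transport-one true  eqb | swapped eq = false , trans (eq false) eqb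

    -- Only the multiset of runners 0 and 1 at each level is known in W, so the runner v carrying
    -- the violation in W is not under control.
    both-gaps⇒violation : ∀ {k k′} u → k < k′ → Both W′ k false → W′ k′ (runner u) ≡ true →
      (∀ v → OtherBead ℓ W k (runner v)) → Violation ℓ W
    both-gaps⇒violation {k} u k<k′ gaps bead otherBead with v , beadv ← transport-one u bead =
      violation k<k′ (runner<ℓ v) (transport-both gaps v) beadv
        (k , runner (not v) , runner<ℓ (not v) , runner≢ v , transport-both gaps (not v) , inj₁ k<k′)
        (otherBead v)

    both-beads⇒violation : ∀ {k k′} u → k < k′ → W′ k (runner u) ≡ false → Both W′ k′ true →
      (∀ v → OtherGap ℓ W k′ (runner v)) → Violation ℓ W
    both-beads⇒violation {k} {k′} u k<k′ gap beads otherGap with v , gapv ← transport-one u gap =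
      violation k<k′ (runner<ℓ v) gapv (transport-both beads v)
        (otherGap v)
        (k′ , runner (not v) , runner<ℓ (not v) , runner≢ v , transport-both beads (not v) , inj₁ k<k′)

    -- Runners 0 and 1 lie on the same side of `2 + j` within a level, so exchanging them disturbs
    -- neither the order nor the distinctness from `2 + j`; likewise in `transport-otherBead`.
    transport-otherGap : ∀ {k j} → OtherGap ℓ W′ k (2 + j) → OtherGap ℓ W k (2 + j)
    transport-otherGap (m , i , i<ℓ , i≢ , g , m≺) with isRunner i
    ... | rest i′ = m , i , i<ℓ , i≢ , trans (outside m i′ i<ℓ) g , m≺
    ... | pair u with v , gv ← transport-one u g =
      m , runner v , runner<ℓ v , (λ eq → runner≢2+ v (sym eq)) , gv , ≺-above-pair u v m≺

    transport-otherBead : ∀ {k j} → OtherBead ℓ W′ k (2 + j) → OtherBead ℓ W k (2 + j)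
    transport-otherBead (n , i , i<ℓ , i≢ , h , k≺) with isRunner i
    ... | rest i′ = n , i , i<ℓ , i≢ , trans (outside n i′ i<ℓ) h , k≺
    ... | pair u with v , hv ← transport-one u h =
      n , runner v , runner<ℓ v , (λ eq → runner≢2+ v (sym eq)) , hv , inj₁ (≺-below-pair u k≺)

    -- The hypothesis on s says that all signs in the signature of W′ agree.
    reflect-violation : ∀ s → (∀ k → W′ k (runner s) ≡ true → W′ k (runner (not s)) ≡ true) →
                        Violation ℓ W′ → Violation ℓ W
    reflect-violation s terminal (violation {k} {k′} {j} k<k′ j<ℓ gap bead oGap oBead) = on-runner (isRunner j) j<ℓ gap bead oGap oBead
      where
      terminal-gaps : ∀ {m} → W′ m (runner (not s)) ≡ false → Both W′ m false
      terminal-gaps {m} g = both {W′} s (¬-not λ h → not-¬ g (terminal m h)) g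

      terminal-beads : ∀ {m} → W′ m (runner s) ≡ true → Both W′ m true
      terminal-beads {m} h = both {W′} s h (terminal m h)

      gap-for-all : W′ k′ (runner s) ≡ true → OtherGap ℓ W′ k′ (runner s) → ∀ v → OtherGap ℓ W k′ (runner v)
      gap-for-all bead (m , i , i<ℓ , i≢ , g , m≺) v with isRunner i
      ... | rest i′ = m , i , i<ℓ , runner≢2+ v , trans (outside m i′ i<ℓ) g , inj₁ (≺-below-pair s m≺)
      ... | pair w with pair-or-other s w
      ...   | inj₁ refl = ⊥-elim (i≢ refl)
      ...   | inj₂ refl = m , runner (not v) , runner<ℓ (not v) , runner≢ v , transport-both (terminal-gaps g) (not v) , inj₁ (below m≺)
        where
        below : (m , runner (not s)) ≺ (k′ , runner s) → m < k′
        below (inj₁ lt)         = lt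
        -- Level m has gaps on both runners while level k′ has a bead, so the two levels differ.
        below (inj₂ (refl , _)) = ⊥-elim (not-both {W′} s (terminal-gaps g) bead)

      bead-for-all : W′ k (runner (not s)) ≡ false → OtherBead ℓ W′ k (runner (not s)) → ∀ v → OtherBead ℓ W k (runner v)
      bead-for-all gap (n , i , i<ℓ , i≢ , h , k≺) v with isRunner i
      ... | rest i′ = n , i , i<ℓ , runner≢2+ v , trans (outside n i′ i<ℓ) h , ≺-above-pair (not s) v k≺
      ... | pair w with pair-or-other s w
      ...   | inj₂ refl = ⊥-elim (i≢ refl)
      ...   | inj₁ refl = n , runner (not v) , runner<ℓ (not v) , runner≢ v , transport-both (terminal-beads h) (not v) , inj₁ (above k≺)
        where
        above : (k , runner (not s)) ≺ (n , runner s) → k < n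
        above (inj₁ lt)         = lt
        above (inj₂ (refl , _)) = ⊥-elim (not-both {W′} s (terminal-gaps gap) h)

      on-runner : ∀ {j} → IsRunner j → j < ℓ → W′ k j ≡ false → W′ k′ j ≡ true →
                  OtherGap ℓ W′ k′ j → OtherBead ℓ W′ k j → Violation ℓ W
      on-runner (rest j) j<ℓ gap bead oGap oBead = violation k<k′ j<ℓ
        (trans (outside k j j<ℓ) gap) (trans (outside k′ j j<ℓ) bead) (transport-otherGap oGap) (transport-otherBead oBead)
      -- On runner `s` the level of the bead has beads on both runners; on the other runner the
      -- level of the gap has gaps on both. Either way that end of the hook is available in W on
      -- whichever runner the other end occupies.
      on-runner (pair u) _ gap bead oGap oBead with pair-or-other s u
      ... | inj₁ refl = both-beads⇒violation s k<k′ gap (terminal-beads bead) (gap-for-all bead oGap)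
      ... | inj₂ refl = both-gaps⇒violation (not s) k<k′ (terminal-gaps gap) bead (bead-for-all gap oBead)

-- Boolean comparisons, and one added box seen on rows and on the abacus

≡true-ext : ∀ {s t : Bool} → (s ≡ true → t ≡ true) → (t ≡ true → s ≡ true) → s ≡ t
≡true-ext {true}  {true}  f g = refl
≡true-ext {true}  {false} f g = sym (f refl)
≡true-ext {false} {true}  f g = g refl
≡true-ext {false} {false} f g = refl

<⇒<ᵇ≡true : a < b → (a <ᵇ b) ≡ true
<⇒<ᵇ≡true lt = Equivalence.to T-≡ (<⇒<ᵇ lt)

<ᵇ≡true⇒< : (a <ᵇ b) ≡ true → a < b
<ᵇ≡true⇒< {a} {b} eq = <ᵇ⇒< a b (Equivalence.from T-≡ eq)

-- A relation on row lengths, so that adding and removing a box are one relation read in two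
-- directions.
record AddsBox (p p′ : List ℕ) (x : ℕ) : Set where
  constructor addsBox
  field
    1≤x    : 1 ≤ x
    at     : row p′ x ≡ suc (row p x)
    beside : ∀ {z} → 1 ≤ z → z ≢ x → row p′ z ≡ row p z

-- The effect of adding a box of residue i at level k, passing from W to W′.
record Flip (ℓ : ℕ) (W W′ : Abacus) (k : ℕ) : Set where
  field
    before0 : W k 0 ≡ true
    before1 : W k 1 ≡ false
    after0  : W′ k 0 ≡ false
    after1  : W′ k 1 ≡ true
    other   : ∀ m j → j < ℓ → (m ≡ k → 2 ≤ j) → W m j ≡ W′ m j

-- Signatures and cancellation

≡ᵇ≡true⇒≡ : (a ≡ᵇ b) ≡ true → a ≡ b
≡ᵇ≡true⇒≡ {a} {b} eq = ≡ᵇ⇒≡ a b (Equivalence.from T-≡ eq)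

≡⇒≡ᵇ≡true : a ≡ b → (a ≡ᵇ b) ≡ true
≡⇒≡ᵇ≡true {a} {b} eq = Equivalence.to T-≡ (≡⇒≡ᵇ a b eq)

mapMaybe-if⁻ : ∀ (c : ℕ → Bool) (f : ℕ → A) xs {e} →
  e ∈ mapMaybe (λ x → if c x then just (f x) else nothing) xs → ∃ λ x → c x ≡ true × e ≡ f x
mapMaybe-if⁻ c f (x ∷ xs) e∈ with c x in eq
mapMaybe-if⁻ c f (x ∷ xs) (here refl) | true  = x , eq , refl
mapMaybe-if⁻ c f (x ∷ xs) (there e∈)  | true  = mapMaybe-if⁻ c f xs e∈
mapMaybe-if⁻ c f (x ∷ xs) e∈          | false = mapMaybe-if⁻ c f xs e∈

mapMaybe-if⁺ : ∀ (c : ℕ → Bool) (f : ℕ → A) xs {x} → x ∈ xs → c x ≡ true →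
  f x ∈ mapMaybe (λ x → if c x then just (f x) else nothing) xs
mapMaybe-if⁺ c f (x ∷ xs) (here refl) cx with c x
mapMaybe-if⁺ c f (x ∷ xs) (here refl) cx | true = here refl
mapMaybe-if⁺ c f (y ∷ xs) (there x∈) cx with c y
... | true  = there (mapMaybe-if⁺ c f xs x∈ cx)
... | false = mapMaybe-if⁺ c f xs x∈ cx

AllPairs-reverse : ∀ {R : A → A → Set} {xs} → AllPairs R xs → AllPairs (flip R) (reverse xs)
AllPairs-reverse []                         = []
AllPairs-reverse {R = R} {x ∷ xs} (px ∷ pxs) = subst (AllPairs (flip R)) (sym (unfold-reverse x xs))
  (AllPairs.++⁺ (AllPairs-reverse pxs) ([] ∷ []) (All.map (λ r → r ∷ []) (All-resp-↭ (↭-sym (↭-reverse xs)) px)))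

-- `R` is arbitrary because the search for a + runs through the reversed signature, which is sorted
-- for the flipped order.
firstPlus-spec : ∀ {R : Entry → Entry → Set} {es} → AllPairs R es →
  (firstPlus es ≡ nothing × (∀ {r} → (plus , r) ∉ es)) ⊎
  (∃ λ x → ∃ λ y → firstPlus es ≡ just x × (plus , x , y) ∈ es ×
    (∀ {r} → (plus , r) ∈ es → r ≡ (x , y) ⊎ R (plus , x , y) (plus , r)))
firstPlus-spec [] = inj₁ (refl , λ ())
firstPlus-spec {es = (plus , x , y) ∷ es} (px ∷ _) = inj₂ (x , y , refl , here refl , λ where
  (here refl) → inj₁ refl
  (there r∈)  → inj₂ (All.lookup px r∈))
firstPlus-spec {es = (minus , _) ∷ es} (_ ∷ pxs) with firstPlus-spec pxs
... | inj₁ (eq , none) = inj₁ (eq , λ { (there r∈) → none r∈ })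
... | inj₂ (x , y , eq , x∈ , least) = inj₂ (x , y , eq , there x∈ , λ { (there r∈) → least r∈ })

firstMinus-spec : ∀ {R : Entry → Entry → Set} {es} → AllPairs R es →
  (firstMinus es ≡ nothing × (∀ {r} → (minus , r) ∉ es)) ⊎
  (∃ λ x → ∃ λ y → firstMinus es ≡ just x × (minus , x , y) ∈ es ×
    (∀ {r} → (minus , r) ∈ es → r ≡ (x , y) ⊎ R (minus , x , y) (minus , r)))
firstMinus-spec [] = inj₁ (refl , λ ())
firstMinus-spec {es = (minus , x , y) ∷ es} (px ∷ _) = inj₂ (x , y , refl , here refl , λ where
  (here refl) → inj₁ refl
  (there r∈)  → inj₂ (All.lookup px r∈))
firstMinus-spec {es = (plus , _) ∷ es} (_ ∷ pxs) with firstMinus-spec pxs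
... | inj₁ (eq , none) = inj₁ (eq , λ { (there r∈) → none r∈ })
... | inj₂ (x , y , eq , x∈ , least) = inj₂ (x , y , eq , there x∈ , λ { (there r∈) → least r∈ })

data Cancels : Entry → Entry → Set where
  cancels : ∀ {r s} → Cancels (minus , r) (plus , s)

cancelStep-¬cancels : ∀ st e → (∀ {d} → d ∈ st → ¬ Cancels d e) → cancelStep st e ≡ e ∷ st
cancelStep-¬cancels []                e           _  = refl
cancelStep-¬cancels ((plus , _) ∷ _)  e           _  = refl
cancelStep-¬cancels ((minus , _) ∷ _) (minus , _) _  = refl
cancelStep-¬cancels ((minus , _) ∷ _) (plus , _)  nc = ⊥-elim (nc (here refl) cancels)

-- Without a cancelling pair the stack only grows, and reversing it at the end restores the word.
cancelAux-¬cancels : ∀ st es → (∀ {d e} → d ∈ st → e ∈ es → ¬ Cancels d e) →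
  AllPairs (λ d e → ¬ Cancels d e) es → cancelAux st es ≡ reverse st ++ es
cancelAux-¬cancels st []       _  _          = sym (++-identityʳ (reverse st))
cancelAux-¬cancels st (e ∷ es) nc (pe ∷ pes) = begin
  cancelAux (cancelStep st e) es ≡⟨ cong (λ s → cancelAux s es) (cancelStep-¬cancels st e λ d∈ → nc d∈ (here refl)) ⟩
  cancelAux (e ∷ st) es          ≡⟨ cancelAux-¬cancels (e ∷ st) es nc′ pes ⟩
  reverse (e ∷ st) ++ es         ≡⟨ cong (_++ es) (unfold-reverse e st) ⟩
  (reverse st ++ [ e ]) ++ es    ≡⟨ ++-assoc (reverse st) [ e ] es ⟩
  reverse st ++ e ∷ es           ∎
  where
  open ≡-Reasoning
  nc′ : ∀ {d e′} → d ∈ e ∷ st → e′ ∈ es → ¬ Cancels d e′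
  nc′ (here refl) e′∈ = All.lookup pe e′∈
  nc′ (there d∈)  e′∈ = nc d∈ (there e′∈)

AllPairs-map : ∀ {R S : A → A → Set} {xs} → (∀ {a b} → a ∈ xs → b ∈ xs → R a b → S a b) →
  AllPairs R xs → AllPairs S xs
AllPairs-map f []         = []
AllPairs-map f (px ∷ pxs) =
  All.tabulate (λ b∈ → f (here refl) (there b∈) (All.lookup px b∈)) ∷ AllPairs-map (λ a∈ b∈ → f (there a∈) (there b∈)) pxs

-- The ladder order and insertion sort

module Order (ℓ : ℕ) where

  infix 4 _⊑_
  _⊑_ : Entry → Entry → Set
  e ⊑ d = before ℓ e d ≡ true

  rank : Entry → ℕ
  rank (_ , x , y) = ladder ℓ x y

  height : Entry → ℕ
  height (_ , x , _) = x

  Lex : Entry → Entry → Set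
  Lex e d = rank e < rank d ⊎ (rank e ≡ rank d × height e ≤ height d)

  ⊑⇒lex : ∀ e d → e ⊑ d → Lex e d
  ⊑⇒lex e d eq with rank e <ᵇ rank d in lt
  ... | true  = inj₁ (<ᵇ≡true⇒< lt)
  ... | false = inj₂ (≡ᵇ≡true⇒≡ (∧-conicalˡ _ _ eq) ,
                      ≤ᵇ⇒≤ _ _ (Equivalence.from T-≡ (∧-conicalʳ (rank e ≡ᵇ rank d) _ eq)))

  lex⇒⊑ : ∀ e d → Lex e d → e ⊑ d
  lex⇒⊑ e d (inj₁ lt) rewrite <⇒<ᵇ≡true lt = refl
  lex⇒⊑ e d (inj₂ (eq , le)) with rank e <ᵇ rank d
  ... | true = refl
  ... | false rewrite ≡⇒≡ᵇ≡true eq = Equivalence.to T-≡ (≤⇒≤ᵇ le)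

  ⊑-trans : ∀ {e d c} → e ⊑ d → d ⊑ c → e ⊑ c
  ⊑-trans {e} {d} {c} e⊑d d⊑c = lex⇒⊑ e c (lex-trans (⊑⇒lex e d e⊑d) (⊑⇒lex d c d⊑c))
    where
    lex-trans : Lex e d → Lex d c → Lex e c
    lex-trans (inj₁ l)       (inj₁ m)       = inj₁ (<-trans l m)
    lex-trans (inj₁ l)       (inj₂ (m , _)) = inj₁ (<-≤-trans l (≤-reflexive m))
    lex-trans (inj₂ (l , _)) (inj₁ m)       = inj₁ (≤-<-trans (≤-reflexive l) m)
    lex-trans (inj₂ (l , h)) (inj₂ (m , k)) = inj₂ (trans l m , ≤-trans h k)

  ⊑-total : ∀ {e d} → ¬ e ⊑ d → d ⊑ e
  ⊑-total {e} {d} e⋢d with <-cmp (rank e) (rank d) | ≤-total (height e) (height d)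
  ... | tri< lt _ _ | _       = ⊥-elim (e⋢d (lex⇒⊑ e d (inj₁ lt)))
  ... | tri≈ _ eq _ | inj₁ le = ⊥-elim (e⋢d (lex⇒⊑ e d (inj₂ (eq , le))))
  ... | tri≈ _ eq _ | inj₂ ge = lex⇒⊑ d e (inj₂ (sym eq , ge))
  ... | tri> _ _ gt | _       = lex⇒⊑ d e (inj₁ gt)

  -- Equality of rows suffices: among entries of one sign in a given partition, the row determines
  -- the entry.
  ⊑-antisym : ∀ {e d} → e ⊑ d → d ⊑ e → height e ≡ height d
  ⊑-antisym {e} {d} e⊑d d⊑e with ⊑⇒lex e d e⊑d | ⊑⇒lex d e d⊑e
  ... | inj₁ l        | inj₁ m        = ⊥-elim (<-asym l m)
  ... | inj₁ l        | inj₂ (m , _)  = ⊥-elim (<⇒≢ l (sym m))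
  ... | inj₂ (l , _)  | inj₁ m        = ⊥-elim (<⇒≢ m (sym l))
  ... | inj₂ (_ , h)  | inj₂ (_ , k)  = ≤-antisym h k

  insert-↭ : ∀ e ds → insert ℓ e ds ↭ e ∷ ds
  insert-↭ e []       = ↭-refl
  insert-↭ e (d ∷ ds) with before ℓ e d
  ... | true  = ↭-refl
  ... | false = ↭-trans (prep d (insert-↭ e ds)) (swap d e ↭-refl)

  sortEntries-↭ : ∀ es → sortEntries ℓ es ↭ es
  sortEntries-↭ []       = ↭-refl
  sortEntries-↭ (e ∷ es) = ↭-trans (insert-↭ e (sortEntries ℓ es)) (prep e (sortEntries-↭ es))

  insert-sorted : ∀ e {ds} → AllPairs _⊑_ ds → AllPairs _⊑_ (insert ℓ e ds)
  insert-sorted e []         = [] ∷ []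
  insert-sorted e {d ∷ ds} (pd ∷ pds) with before ℓ e d in eq
  ... | true  = (eq ∷ All.map (λ {c} → ⊑-trans {e} {d} {c} eq) pd) ∷ pd ∷ pds
  ... | false = All-resp-↭ (↭-sym (insert-↭ e ds)) (⊑-total {e} {d} (not-¬ eq) ∷ pd) ∷ insert-sorted e pds

  sortEntries-sorted : ∀ es → AllPairs _⊑_ (sortEntries ℓ es)
  sortEntries-sorted []       = []
  sortEntries-sorted (e ∷ es) = insert-sorted e (sortEntries-sorted es)

-- Adding and removing boxes

addsBox-∷ : ∀ r → AddsBox p p′ (suc x) → AddsBox (r ∷ p) (r ∷ p′) (suc (suc x))
addsBox-∷ {p} {p′} {x} r (addsBox _ at beside) = addsBox (s≤s z≤n) at rest-rows
  where
  rest-rows : ∀ {z} → 1 ≤ z → z ≢ suc (suc x) → row (r ∷ p′) z ≡ row (r ∷ p) z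
  rest-rows {suc zero}    _ _  = refl
  rest-rows {suc (suc z)} _ z≢ = beside (s≤s z≤n) (λ eq → z≢ (cong suc eq))

linked-rows : ∀ p → (∀ a → row p (suc (suc a)) ≤ row p (suc a)) → Linked (λ a b → b ≤ a) p
linked-rows []          _   = []
linked-rows (_ ∷ [])    _   = [-]
linked-rows (_ ∷ _ ∷ p) dec = dec 0 ∷ linked-rows _ (λ a → dec (suc a))

-- Past the first empty row `addBox` changes nothing, hence the bound.
addBox-addsBox : ∀ p x → x ≤ length p → AddsBox p (addBox (suc x) p) (suc x)
addBox-addsBox []       zero    _         = addsBox (s≤s z≤n) refl λ { {suc zero} _ z≢ → ⊥-elim (z≢ refl) ; {suc (suc z)} _ _ → refl }
addBox-addsBox (r ∷ rs) zero    _         = addsBox (s≤s z≤n) refl λ { {suc zero} _ z≢ → ⊥-elim (z≢ refl) ; {suc (suc z)} _ _ → refl }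
addBox-addsBox (r ∷ rs) (suc x) (s≤s x≤n) = addsBox-∷ r (addBox-addsBox rs x x≤n)

addBox-positive : ∀ x → All (0 <_) p → All (0 <_) (addBox x p)
addBox-positive zero          pos         = pos
addBox-positive (suc zero)    []          = s≤s z≤n ∷ []
addBox-positive (suc zero)    (_ ∷ pos)   = s≤s z≤n ∷ pos
addBox-positive (suc (suc x)) []          = []
addBox-positive (suc (suc x)) (pr ∷ pos)  = pr ∷ addBox-positive (suc x) pos

length-addBox : ∀ x p → length p ≤ length (addBox x p)
length-addBox zero          p        = ≤-refl
length-addBox (suc zero)    []       = z≤n
length-addBox (suc zero)    (_ ∷ _)  = ≤-refl
length-addBox (suc (suc x)) []       = z≤n
length-addBox (suc (suc x)) (_ ∷ rs) = s≤s (length-addBox (suc x) rs)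

-- Deleting a row of length 1 from the list would move later rows up; positivity and strict descent
-- make it the last row.
removeBox-addsBox : ∀ p x → All (0 <_) p → row p (suc (suc x)) < row p (suc x) →
  AddsBox (removeBox (suc x) p) p (suc x)
removeBox-addsBox []                        zero    _ ()
removeBox-addsBox (suc zero ∷ [])           zero    _ _ =
  addsBox (s≤s z≤n) refl λ { {suc zero} _ z≢ → ⊥-elim (z≢ refl) ; {suc (suc z)} _ _ → refl }
removeBox-addsBox (suc zero ∷ zero ∷ _)     zero    (_ ∷ () ∷ _) _
removeBox-addsBox (suc zero ∷ suc _ ∷ _)    zero    _ (s≤s ())
removeBox-addsBox (suc (suc r) ∷ rs)        zero    _ _ =
  addsBox (s≤s z≤n) refl λ { {suc zero} _ z≢ → ⊥-elim (z≢ refl) ; {suc (suc z)} _ _ → refl }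
removeBox-addsBox (r ∷ rs)                  (suc x) (_ ∷ pos) lt = addsBox-∷ r (removeBox-addsBox rs x pos lt)

removeBox-positive : ∀ x → All (0 <_) p → All (0 <_) (removeBox x p)
removeBox-positive zero          pos                        = pos
removeBox-positive (suc zero)    []                         = []
removeBox-positive {suc zero ∷ _}    (suc zero) (_ ∷ pos)   = pos
removeBox-positive {suc (suc _) ∷ _} (suc zero) (_ ∷ pos)   = s≤s z≤n ∷ pos
removeBox-positive (suc (suc x)) []                         = []
removeBox-positive (suc (suc x)) (pr ∷ pos)                 = pr ∷ removeBox-positive (suc x) pos

length-removeBox : ∀ x p → length (removeBox x p) ≤ length p
length-removeBox zero          p                  = ≤-refl
length-removeBox (suc zero)    []                 = z≤n
length-removeBox (suc zero)    (zero ∷ _)         = ≤-refl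
length-removeBox (suc zero)    (suc zero ∷ rs)    = n≤1+n _
length-removeBox (suc zero)    (suc (suc _) ∷ _)  = ≤-refl
length-removeBox (suc (suc x)) []                 = z≤n
length-removeBox (suc (suc x)) (_ ∷ rs)           = s≤s (length-removeBox (suc x) rs)

isAddable⇒< : ∀ p x → isAddable p (suc (suc x)) ≡ true → row p (suc (suc x)) < row p (suc x)
isAddable⇒< p x eq = <ᵇ≡true⇒< eq

isAddable⇒≤length : ∀ p x → isAddable p (suc x) ≡ true → x ≤ length p
isAddable⇒≤length p zero    _  = z≤n
isAddable⇒≤length p (suc x) eq = ≮⇒≥ λ n<x →
  <⇒≱ (<-≤-trans (isAddable⇒< p x eq) (≤-reflexive (row-beyond p n<x))) z≤n

isRemovable⇒≤length : ∀ p x → isRemovable p (suc x) ≡ true → suc x ≤ length p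
isRemovable⇒≤length p x eq = ≮⇒≥ λ n<x →
  <⇒≱ (<-≤-trans (<ᵇ≡true⇒< eq) (≤-reflexive (row-beyond p n<x))) z≤n

addBox-partition : ∀ p x → IsPartition p → isAddable p (suc x) ≡ true → IsPartition (addBox (suc x) p)
addBox-partition p x P ok = addBox-positive (suc x) (proj₁ P) , linked-rows _ dec
  where
  added : List ℕ
  added = addBox (suc x) p
  open AddsBox (addBox-addsBox p x (isAddable⇒≤length p x ok))
  dec : ∀ a → row added (suc (suc a)) ≤ row added (suc a)
  dec a with suc (suc a) ≟ suc x | suc a ≟ suc x
  ... | yes refl | yes ()
  ... | yes refl | no a≢ = subst₂ _≤_ (sym at) (sym (beside (s≤s z≤n) a≢)) (isAddable⇒< p a ok)
  ... | no a≢    | yes refl = subst₂ _≤_ (sym (beside (s≤s z≤n) a≢)) (sym at) (m≤n⇒m≤1+n (row-step P a))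
  ... | no a≢    | no b≢ = subst₂ _≤_ (sym (beside (s≤s z≤n) a≢)) (sym (beside (s≤s z≤n) b≢)) (row-step P a)

removeBox-partition : ∀ p x → IsPartition p → isRemovable p (suc x) ≡ true → IsPartition (removeBox (suc x) p)
removeBox-partition p x P ok = removeBox-positive (suc x) (proj₁ P) , linked-rows _ dec
  where
  removed : List ℕ
  removed = removeBox (suc x) p
  open AddsBox (removeBox-addsBox p x (proj₁ P) (<ᵇ≡true⇒< ok))
  dec : ∀ a → row removed (suc (suc a)) ≤ row removed (suc a)
  dec a with suc (suc a) ≟ suc x | suc a ≟ suc x
  ... | yes refl | yes ()
  ... | yes refl | no a≢ = ≤-trans (n≤1+n _) (subst₂ _≤_ at (beside (s≤s z≤n) a≢) (row-step P a))
  ... | no a≢    | yes refl = ≤-pred (subst₂ _<_ (beside (s≤s z≤n) a≢) at (<ᵇ≡true⇒< ok))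
  ... | no a≢    | no b≢ = subst₂ _≤_ (beside (s≤s z≤n) a≢) (beside (s≤s z≤n) b≢) (row-step P a)

-- Chains of divisible hooks

-- The first value is a positive multiple of ℓ, and each increase between multiples of ℓ is by at
-- least ℓ.
divisible-descent : ∀ ℓ (f : ℕ → ℕ) N → (∀ m → m ≤ N → ℓ ∣ f m) → 0 < f 0 →
  (∀ m → m < N → f m < f (suc m)) → ℓ * suc N ≤ f N
divisible-descent ℓ f zero    divs pos inc =
  subst (_≤ f 0) (sym (*-identityʳ ℓ)) (∣⇒≤ ⦃ >-nonZero pos ⦄ (divs 0 z≤n))
divisible-descent ℓ f (suc N) divs pos inc with divs (suc N) ≤-refl
... | divides c eq = begin
  ℓ * suc (suc N) ≤⟨ *-monoʳ-≤ ℓ N<c ⟩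
  ℓ * c           ≡⟨ *-comm ℓ c ⟩
  c * ℓ           ≡⟨ eq ⟨
  f (suc N)       ∎
  where
  open ≤-Reasoning
  N<c : suc N < c
  N<c = *-cancelˡ-< ℓ (suc N) c (begin-strict
    ℓ * suc N ≤⟨ divisible-descent ℓ f N (λ m m≤N → divs m (m≤n⇒m≤1+n m≤N)) pos (λ m m<N → inc m (m<n⇒m<1+n m<N)) ⟩
    f N       <⟨ inc N ≤-refl ⟩
    f (suc N) ≡⟨ eq ⟩
    c * ℓ     ≡⟨ *-comm c ℓ ⟩
    ℓ * c     ∎)

colLen-antitone : IsPartition p → 1 ≤ a → a ≤ b → colLen p b ≤ colLen p a
colLen-antitone {p} {a} {b} P 1≤a a≤b with colLen p b in eq
... | zero  = z≤n
... | suc c = row⇒col P (s≤s z≤n) 1≤a (≤-trans a≤b (col⇒row P (s≤s z≤n) (≤-reflexive (sym eq))))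

hook-decreases-down : IsPartition p → 1 ≤ a → suc a ≤ colLen p b → hook p (suc a) b < hook p a b
hook-decreases-down {p} {a} {b} P 1≤a a<c = +-monoˡ-< 1
  (+-mono-≤-< (∸-monoˡ-≤ b (row-antitone P 1≤a (n≤1+n a))) (∸-monoʳ-< (n<1+n a) a<c))

hook-decreases-right : IsPartition p → 1 ≤ b → suc b ≤ row p a → hook p a (suc b) < hook p a b
hook-decreases-right {p} {b} {a} P 1≤b b<r = +-monoˡ-< 1
  (+-mono-<-≤ (∸-monoʳ-< (n<1+n b) b<r) (∸-monoˡ-≤ a (colLen-antitone P 1≤b (n≤1+n b))))

-- Related abaci and flips

identical : ∀ {ℓ W} → Related ℓ W W
identical = record { outside = λ _ _ _ → refl ; inside = λ _ → kept λ _ → refl }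

related-trans : ∀ {ℓ W V U} → Related ℓ W V → Related ℓ V U → Related ℓ W U
related-trans {W = W} {V} {U} R S = record
  { outside = λ k j j<ℓ → trans (R.outside k j j<ℓ) (S.outside k j j<ℓ)
  ; inside  = λ k → compose (R.inside k) (S.inside k)
  }
  where
  module R = Related R
  module S = Related S
  not² : ∀ u → not (not u) ≡ u
  not² false = refl
  not² true  = refl
  compose : ∀ {k} → Swap01 W V k → Swap01 V U k → Swap01 W U k
  compose (kept e)    (kept f)    = kept λ u → trans (e u) (f u)
  compose (kept e)    (swapped f) = swapped λ u → trans (e u) (f u)
  compose (swapped e) (kept f)    = swapped λ u → trans (e u) (f (not u))
  compose {k} (swapped e) (swapped f) = kept λ u → trans (e u) (trans (f (not u)) (cong (λ v → U k (runner v)) (not² u)))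

related-sym : ∀ {ℓ W V} → Related ℓ W V → Related ℓ V W
related-sym {W = W} {V} R = record
  { outside = λ k j j<ℓ → sym (outside k j j<ℓ)
  ; inside  = λ k → reverse-swap (inside k)
  }
  where
  open Related R
  reverse-swap : ∀ {k} → Swap01 W V k → Swap01 V W k
  reverse-swap (kept e)    = kept λ u → sym (e u)
  reverse-swap (swapped e) = swapped λ { false → sym (e true) ; true → sym (e false) }

flip⇒related : ∀ {ℓ W V k} → 2 < ℓ → Flip ℓ W V k → Related ℓ W V
flip⇒related {ℓ} {W} {V} {k} 2<ℓ F = record
  { outside = λ m j j<ℓ → other m (2 + j) j<ℓ (λ _ → s≤s (s≤s z≤n))
  ; inside  = inside
  }
  where
  open Flip F
  inside : ∀ m → Swap01 W V m
  inside m with m ≟ k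
  ... | yes refl = swapped λ { false → trans before0 (sym after1) ; true → trans before1 (sym after0) }
  ... | no m≢k   = kept λ u → other m (runner u) (runner<ℓ 2<ℓ u) (λ eq → ⊥-elim (m≢k eq))

-- The first flip leaves a - in W. The next two use distinct levels, because a flipped level has
-- become a -, so both of their +'s are already present in W.
three-flips⇒violation : ∀ {ℓ V W W′ W″ v u₁ u₂} → 2 < ℓ →
  Flip ℓ V W v → Flip ℓ W W′ u₁ → Flip ℓ W′ W″ u₂ → Violation ℓ W
three-flips⇒violation {ℓ} {W = W} {W′} {u₁ = u₁} {u₂} 2<ℓ F G H with <-cmp u₁ u₂
... | tri≈ _ refl _ with () ← trans (sym (Flip.before0 H)) (Flip.after0 G)
... | tri< u₁<u₂ _ _ = two-pluses-minus⇒violation 2<ℓ u₁<u₂ (before0 G) (before1 G)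
        (trans (other G u₂ 0 (runner<ℓ 2<ℓ false) λ eq → ⊥-elim (<⇒≢ u₁<u₂ (sym eq))) (before0 H))
        (trans (other G u₂ 1 (runner<ℓ 2<ℓ true) λ eq → ⊥-elim (<⇒≢ u₁<u₂ (sym eq))) (before1 H))
        (after0 F) (after1 F)
        where open Flip
... | tri> _ _ u₂<u₁ = two-pluses-minus⇒violation 2<ℓ u₂<u₁
        (trans (other G u₂ 0 (runner<ℓ 2<ℓ false) λ eq → ⊥-elim (<⇒≢ u₂<u₁ eq)) (before0 H))
        (trans (other G u₂ 1 (runner<ℓ 2<ℓ true) λ eq → ⊥-elim (<⇒≢ u₂<u₁ eq)) (before1 H))
        (before0 G) (before1 G) (after0 F) (after1 F)
        where open Flip

-- Iterates of a partial operator

module Iterates (g : Maybe (List ℕ) → Maybe (List ℕ)) (g-nothing : g nothing ≡ nothing) where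

  iter-pred : ∀ k → iter (suc k) g (just p) ≡ just μ → ∃ λ ν → iter k g (just p) ≡ just ν × g (just ν) ≡ just μ
  iter-pred {p} k eq with iter k g (just p)
  ... | just ν = ν , refl , eq
  ... | nothing with () ← trans (sym g-nothing) eq

  iter-defined : ∀ {k n} → k ≤′ n → ¬ iter n g (just p) ≡ nothing → ∃ λ ν → iter k g (just p) ≡ just ν
  iter-defined {p} {k} ≤′-refl ≢nothing with iter k g (just p)
  ... | just ν  = ν , refl
  ... | nothing = ⊥-elim (≢nothing refl)
  iter-defined (≤′-step k≤n) ≢nothing = iter-defined k≤n λ eq → ≢nothing (trans (cong g eq) g-nothing)

  next : ∀ {k n} → k < n → ¬ iter n g (just p) ≡ nothing → iter k g (just p) ≡ just μ → ∃ λ ν → g (just μ) ≡ just ν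
  next k<n ≢nothing eq with ν , eq′ ← iter-defined (≤⇒≤′ k<n) ≢nothing = ν , trans (cong g (sym eq)) eq′

  stops-at-max : ∀ {n} → IsMaxNonzero g p n → iter n g (just p) ≡ just μ → ∀ {ν} → g (just μ) ≢ just ν
  stops-at-max {n = n} (_ , maximal) eq eq′ = <-irrefl refl (maximal (suc n) λ stop →
    just≢nothing (trans (sym (trans (cong g eq) eq′)) stop))
    where
    just≢nothing : ∀ {ν : List ℕ} → just ν ≢ nothing
    just≢nothing ()

-- The ladder crystal for residue i and ℓ = l + 1

module LadderCrystal (l : ℕ) (1<l : 1 < l) (i : ℕ) (i<ℓ : i < suc l) where

  ℓ : ℕ
  ℓ = suc l

  2<ℓ : 2 < ℓ
  2<ℓ = s≤s 1<l

  open Order ℓ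

  -- Positions, levels and runners

  position-< : ∀ {m i k j} → i < ℓ → m < k → i + m * ℓ < j + k * ℓ
  position-< {m} {i} {k} {j} i<ℓ m<k = begin-strict
    i + m * ℓ <⟨ +-monoˡ-< (m * ℓ) i<ℓ ⟩
    suc m * ℓ ≤⟨ *-monoˡ-≤ ℓ m<k ⟩
    k * ℓ     ≤⟨ m≤n+m (k * ℓ) j ⟩
    j + k * ℓ ∎
    where open ≤-Reasoning

  ≺⇒< : ∀ {m i k j} → i < ℓ → (m , i) ≺ (k , j) → i + m * ℓ < j + k * ℓ
  ≺⇒< i<ℓ (inj₁ m<k) = position-< i<ℓ m<k
  ≺⇒< {m} i<ℓ (inj₂ (refl , i<j)) = +-monoˡ-< (m * ℓ) i<j

  <⇒≺ : ∀ {m i k j} → j < ℓ → i + m * ℓ < j + k * ℓ → (m , i) ≺ (k , j)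
  <⇒≺ {m} {i} {k} {j} j<ℓ lt with <-cmp m k
  ... | tri< m<k _ _  = inj₁ m<k
  ... | tri≈ _ refl _ = inj₂ (refl , +-cancelʳ-< (m * ℓ) i j lt)
  ... | tri> _ _ k<m  = ⊥-elim (<-asym lt (position-< {j = i} j<ℓ k<m))

  position-% : ∀ {j} k → j < ℓ → (j + k * ℓ) % ℓ ≡ j
  position-% {j} k j<ℓ = trans ([m+kn]%n≡m%n j k ℓ) (m<n⇒m%n≡m j<ℓ)

  position-injective : ∀ {m i k j} → i < ℓ → j < ℓ → i + m * ℓ ≡ j + k * ℓ → m ≡ k × i ≡ j
  position-injective {m} {i} {k} {j} i<ℓ j<ℓ eq with i≡j ← trans (sym (position-% m i<ℓ)) (trans (cong (_% ℓ) eq) (position-% k j<ℓ)) =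
    *-cancelʳ-≡ m k ℓ (+-cancelˡ-≡ i _ _ (trans eq (cong (_+ k * ℓ) (sym i≡j)))) , i≡j

  ∣⇒%≡ : ∀ g {h} → q ≡ g + h → ℓ ∣ h → q % ℓ ≡ g % ℓ
  ∣⇒%≡ g eq ℓ∣h = trans (cong (_% ℓ) eq) (%-remove-+ʳ g ℓ∣h)

  %≡⇒∣ : ∀ g {h} → q ≡ g + h → q % ℓ ≡ g % ℓ → ℓ ∣ h
  %≡⇒∣ {q} g {h} eq q≡g = ∣m+n∣m⇒∣n (subst (ℓ ∣_) lemma (n∣m*n (q / ℓ))) (n∣m*n (g / ℓ))
    where
    lemma : q / ℓ * ℓ ≡ g / ℓ * ℓ + h
    lemma = +-cancelˡ-≡ (g % ℓ) _ _ (begin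
      g % ℓ + q / ℓ * ℓ       ≡⟨ cong (_+ q / ℓ * ℓ) q≡g ⟨
      q % ℓ + q / ℓ * ℓ       ≡⟨ m≡m%n+[m/n]*n q ℓ ⟨
      q                       ≡⟨ eq ⟩
      g + h                   ≡⟨ cong (_+ h) (m≡m%n+[m/n]*n g ℓ) ⟩
      g % ℓ + g / ℓ * ℓ + h   ≡⟨ +-assoc (g % ℓ) _ h ⟩
      g % ℓ + (g / ℓ * ℓ + h) ∎)
      where open ≡-Reasoning

  abacus : ℕ → List ℕ → Abacus
  abacus L p k j = maya L p (j + k * ℓ)

  abacus-at : ∀ L p q → abacus L p (q / ℓ) (q % ℓ) ≡ maya L p q
  abacus-at L p q = cong (maya L p) (sym (m≡m%n+[m/n]*n q ℓ))

  coordinates-≺ : g < q → (g / ℓ , g % ℓ) ≺ (q / ℓ , q % ℓ)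
  coordinates-≺ {g} {q} g<q = <⇒≺ (m%n<n q ℓ) (subst₂ _<_ (m≡m%n+[m/n]*n g ℓ) (m≡m%n+[m/n]*n q ℓ) g<q)

  -- The JM condition as absence of violations

  module _ {L : ℕ} (P : IsPartition p) (n<L : length p < L) where

    row-bead : 1 ≤ a → 1 ≤ b → b ≤ row p a → ∃ λ q → BeadAt L p q a
    row-bead {a} {b} 1≤a 1≤b b≤r =
      bead-of-row {p = p} (≤-trans (row⇒col P 1≤a 1≤b b≤r) (≤-trans (colLen≤length p b) (<⇒≤ n<L)))

    ¬violation⇒JM : ¬ Violation ℓ (abacus L p) → JM ℓ p
    ¬violation⇒JM none (a , b , x , y , (1≤a , 1≤b , b≤) , (_ , 1≤y , y≤) , (1≤x , _ , b≤′) , ∣ab , ∤ay , ∤xb)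
      with row-bead 1≤a 1≤b b≤ | gap-of-column n<L b | gap-of-column n<L y | row-bead 1≤x 1≤b b≤′
    ... | q , bq | g , gg | g′ , gg′ | q′ , bq′ = none (violation k<k′ (m%n<n q ℓ)
          (subst (λ j → abacus L p (g / ℓ) j ≡ false) (sym q≡g) (trans (abacus-at L p g) (false-maya P 1≤b gg)))
          (trans (abacus-at L p q) (true-maya n<L 1≤a bq))
          (g′ / ℓ , g′ % ℓ , m%n<n g′ ℓ , (λ eq → ∤ay (%≡⇒∣ g′ (box⇒hook P 1≤a 1≤y bq gg′ y≤) (sym eq)))
            , trans (abacus-at L p g′) (false-maya P 1≤y gg′)
            , coordinates-≺ (box⇒gap<bead P 1≤a 1≤y bq gg′ y≤))
          (q′ / ℓ , q′ % ℓ , m%n<n q′ ℓ , (λ eq → ∤xb (%≡⇒∣ g (box⇒hook P 1≤x 1≤b bq′ gg b≤′) (trans eq q≡g)))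
            , trans (abacus-at L p q′) (true-maya n<L 1≤x bq′)
            , subst (λ j → (g / ℓ , j) ≺ (q′ / ℓ , q′ % ℓ)) (sym q≡g) (coordinates-≺ (box⇒gap<bead P 1≤x 1≤b bq′ gg b≤′))))
      where
      q≡g : q % ℓ ≡ g % ℓ
      q≡g = ∣⇒%≡ g (box⇒hook P 1≤a 1≤b bq gg b≤) ∣ab
      k<k′ : g / ℓ < q / ℓ
      -- Gap and bead share a runner, so their order is decided by the levels.
      k<k′ with coordinates-≺ (box⇒gap<bead P 1≤a 1≤b bq gg b≤)
      ... | inj₁ lt = lt
      ... | inj₂ (_ , lt) = ⊥-elim (<-irrefl (sym q≡g) lt)

    JM⇒¬violation : JM ℓ p → ¬ Violation ℓ (abacus L p)
    JM⇒¬violation jm (violation {k} {k′} {j} k<k′ j<ℓ gap bead (m , j₁ , j₁<ℓ , j₁≢j , gap₁ , ≺₁) (n , j₂ , j₂<ℓ , j₂≢j , bead₂ , ≺₂))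
      with maya-true bead | maya-false P n<L gap | maya-false P n<L gap₁ | maya-true bead₂
    ... | a , 1≤a , bq | b , 1≤b , gg | y , 1≤y , gg₁ | x , 1≤x , bq₂ =
          jm (a , b , x , y , (1≤a , 1≤b , b≤) , (1≤a , 1≤y , y≤) , (1≤x , 1≤b , b≤₂)
             , %≡⇒∣ (j + k * ℓ) (box⇒hook P 1≤a 1≤b bq gg b≤) (trans (position-% k′ j<ℓ) (sym (position-% k j<ℓ)))
             , (λ ∣ay → j₁≢j (trans (sym (position-% m j₁<ℓ)) (trans (sym (∣⇒%≡ (j₁ + m * ℓ) (box⇒hook P 1≤a 1≤y bq gg₁ y≤) ∣ay)) (position-% k′ j<ℓ))))
             , (λ ∣xb → j₂≢j (trans (sym (position-% n j₂<ℓ)) (trans (∣⇒%≡ (j + k * ℓ) (box⇒hook P 1≤x 1≤b bq₂ gg b≤₂) ∣xb) (position-% k j<ℓ)))))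
      where
      b≤ = bead>gap⇒box P 1≤a bq gg (position-< {j = j} j<ℓ k<k′)
      y≤ = bead>gap⇒box P 1≤a bq gg₁ (≺⇒< j₁<ℓ ≺₁)
      b≤₂ = bead>gap⇒box P 1≤x bq₂ gg (≺⇒< j<ℓ ≺₂)

  -- Boxes of residue i on the abacus

  Addable Removable : List ℕ → ℕ → Set
  Addable   p x = isAddable p x ≡ true × res ℓ x (suc (row p x)) ≡ i
  Removable p x = isRemovable p x ≡ true × res ℓ x (row p x) ≡ i

  -- Shifted so that adding a box of residue i moves a bead from runner 0 to runner 1.
  offset : ℕ → ℕ
  offset M = ℓ * M + suc (ℓ ∸ i)

  -- Modulo ℓ the offset is 1 - i, so q + i is r + 1 - x. The multiples of ℓ added in the proof
  -- account for `res` writing -x as `l * x`.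
  residue-position : ∀ {M r} → q + x ≡ r + offset M → (q + i) % ℓ ≡ res ℓ x (suc r)
  residue-position {q} {x} {M} {r} eq = begin
    (q + i) % ℓ                             ≡⟨ [m+kn]%n≡m%n (q + i) x ℓ ⟨
    (q + i + x * ℓ) % ℓ                     ≡⟨ cong (_% ℓ) lemma ⟩
    (suc r + l * x + suc M * ℓ) % ℓ         ≡⟨ [m+kn]%n≡m%n (suc r + l * x) (suc M) ℓ ⟩
    (suc r + l * x) % ℓ                     ∎
    where
    open ≡-Reasoning
    shuffle₁ : ∀ q i x l → q + i + x * suc l ≡ q + x + (i + l * x)
    shuffle₁ = solve-∀
    shuffle₂ : ∀ r s M D i l x → r + (s * M + suc D) + (i + l * x) ≡ suc r + l * x + (s * M + (D + i))
    shuffle₂ = solve-∀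
    lemma : q + i + x * ℓ ≡ suc r + l * x + suc M * ℓ
    lemma = begin
      q + i + x * ℓ                             ≡⟨ shuffle₁ q i x l ⟩
      q + x + (i + l * x)                       ≡⟨ cong (_+ (i + l * x)) eq ⟩
      r + offset M + (i + l * x)                ≡⟨ shuffle₂ r ℓ M (ℓ ∸ i) i l x ⟩
      suc r + l * x + (ℓ * M + (ℓ ∸ i + i))     ≡⟨ cong (λ s → suc r + l * x + (ℓ * M + s)) (m∸n+n≡m (<⇒≤ i<ℓ)) ⟩
      suc r + l * x + (ℓ * M + ℓ)               ≡⟨ cong (suc r + l * x +_) (trans (+-comm (ℓ * M) ℓ) (cong (ℓ +_) (*-comm ℓ M))) ⟩
      suc r + l * x + suc M * ℓ                 ∎

  residue⇒level : ∀ {M r} → q + x ≡ r + offset M → res ℓ x (suc r) ≡ i → ∃ λ k → q ≡ k * ℓ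
  residue⇒level {q} {M = M} eq res≡i = (q + i) / ℓ , +-cancelʳ-≡ i q _ (begin
    q + i                          ≡⟨ m≡m%n+[m/n]*n (q + i) ℓ ⟩
    (q + i) % ℓ + (q + i) / ℓ * ℓ  ≡⟨ cong (_+ (q + i) / ℓ * ℓ) (trans (residue-position {M = M} eq) res≡i) ⟩
    i + (q + i) / ℓ * ℓ            ≡⟨ +-comm i _ ⟩
    (q + i) / ℓ * ℓ + i            ∎)
    where open ≡-Reasoning

  level⇒residue : ∀ {M r} k → k * ℓ + x ≡ r + offset M → res ℓ x (suc r) ≡ i
  level⇒residue {M = M} k eq = trans (sym (residue-position {M = M} eq))
    (trans (cong (_% ℓ) (+-comm (k * ℓ) i)) (position-% k i<ℓ))

  module _ (M : ℕ) where

    -- The bead of the row moves from kℓ to kℓ + 1. The column of the new box, `suc (row p x)`, is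
    -- the gap at kℓ + 1 before and, being one longer, at kℓ afterwards.
    addsBox⇒flip : IsPartition p → IsPartition p′ → length p < offset M → length p′ < offset M →
      AddsBox p p′ x → res ℓ x (suc (row p x)) ≡ i → ∃ λ k → Flip ℓ (abacus (offset M) p) (abacus (offset M) p′) k
    addsBox⇒flip {p} {p′} {suc x} P P′ n<L n′<L (addsBox 1≤x at beside) res≡i
      with bead-of-row {p = p} (≤-trans (row⇒col P′ 1≤x (s≤s z≤n) (≤-reflexive (sym at))) (≤-trans (colLen≤length p′ _) (<⇒≤ n′<L)))
    ... | q , beadAt bead-eq₀ with residue⇒level {M = M} bead-eq₀ res≡i
    ...   | k , q≡kℓ = k , record
      { before0 = true-maya n<L 1≤x (beadAt position)
      ; before1 = false-maya {b = suc (row p (suc x))} P (s≤s z≤n) (gapAt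
          (trans (cong (λ c → suc (k * ℓ) + suc c) (colLen-unique {a = x} P (s≤s z≤n) before-le ≤-refl)) (cong suc position)))
      ; after0  = false-maya {b = suc (row p (suc x))} P′ (s≤s z≤n) (gapAt
          (trans (cong (λ c → k * ℓ + suc c) (colLen-unique {a = suc x} P′ (s≤s z≤n) (λ _ → ≤-reflexive (sym at)) after-lt))
                 (trans (+-suc (k * ℓ) (suc x)) (cong suc position))))
      ; after1  = true-maya n′<L 1≤x (beadAt (trans (cong suc position) (cong (_+ offset M) (sym at))))
      ; other   = λ m j j<ℓ away → ≡true-ext (forward m j j<ℓ away) (backward m j j<ℓ away)
      }
      where
      position : k * ℓ + suc x ≡ row p (suc x) + offset M
      position = trans (cong (_+ suc x) (sym q≡kℓ)) bead-eq₀
      before-le : 1 ≤ x → suc (row p (suc x)) ≤ row p x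
      before-le 1≤x = subst₂ _≤_ at (beside 1≤x (<⇒≢ (n<1+n x))) (row-antitone P′ 1≤x (n≤1+n x))
      after-lt : row p′ (suc (suc x)) < suc (row p (suc x))
      after-lt = s≤s (subst (_≤ row p (suc x)) (sym (beside (s≤s z≤n) λ ())) (row-antitone {a = suc x} P (s≤s z≤n) (n≤1+n _)))
      1<ℓ : 1 < ℓ
      1<ℓ = <⇒≤ 2<ℓ
      -- The changed row has its bead on runner 0 of level k before and on runner 1 after; `away`
      -- excludes both, so any bead met here belongs to an unchanged row.
      forward : ∀ m j → j < ℓ → (m ≡ k → 2 ≤ j) → abacus (offset M) p m j ≡ true → abacus (offset M) p′ m j ≡ true
      forward m j j<ℓ away eq with maya-true eq
      ... | a , 1≤a , beadAt eqa with a ≟ suc x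
      ...   | no a≢ = true-maya n′<L 1≤a (beadAt (trans eqa (cong (_+ offset M) (sym (beside 1≤a a≢)))))
      ...   | yes refl with position-injective {m = m} {k = k} j<ℓ (s≤s z≤n) (+-cancelʳ-≡ (suc x) _ _ (trans eqa (sym position)))
      ...     | m≡k , refl with () ← away m≡k
      backward : ∀ m j → j < ℓ → (m ≡ k → 2 ≤ j) → abacus (offset M) p′ m j ≡ true → abacus (offset M) p m j ≡ true
      backward m j j<ℓ away eq with maya-true eq
      ... | a , 1≤a , beadAt eqa with a ≟ suc x
      ...   | no a≢ = true-maya n<L 1≤a (beadAt (trans eqa (cong (_+ offset M) (beside 1≤a a≢))))
      ...   | yes refl with position-injective {m = m} {k = k} j<ℓ 1<ℓ (+-cancelʳ-≡ (suc x) _ _ (trans eqa (trans (cong (_+ offset M) at) (cong suc (sym position)))))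
      ...     | m≡k , refl with s≤s () ← away m≡k

    -- A bead on runner 0 is a row whose next box has residue i. As that box is not addable, the row
    -- above has the same length and its bead is the next position.
    no-addable⇒terminal : IsPartition p → length p < offset M → (∀ x → ¬ Addable p x) →
      ∀ k → abacus (offset M) p k 0 ≡ true → abacus (offset M) p k 1 ≡ true
    no-addable⇒terminal {p} P n<L none k bead with maya-true bead
    ... | suc zero , 1≤a , beadAt ba = ⊥-elim (none 1 (refl , level⇒residue {M = M} k ba))
    ... | suc (suc a) , 1≤a , beadAt ba with row p (suc (suc a)) <? row p (suc a)
    ...   | yes lt = ⊥-elim (none _ (<⇒<ᵇ≡true lt , level⇒residue {M = M} k ba))
    ...   | no ≮ = true-maya n<L (s≤s z≤n) (beadAt (begin
      suc (k * ℓ) + suc a     ≡⟨ +-suc (k * ℓ) (suc a) ⟨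
      k * ℓ + suc (suc a)     ≡⟨ ba ⟩
      row p (suc (suc a)) + offset M ≡⟨ cong (_+ offset M) (≤-antisym (row-step P a) (≮⇒≥ ≮)) ⟩
      row p (suc a) + offset M       ∎))
      where open ≡-Reasoning

    -- A row with its bead on runner 1 cannot end in a removable box, so the row below is equally
    -- long and its bead is one position lower.
    no-removable⇒terminal : IsPartition p → length p < offset M → (∀ x → ¬ Removable p x) →
      ∀ k → abacus (offset M) p k 1 ≡ true → abacus (offset M) p k 0 ≡ true
    no-removable⇒terminal {p} P n<L none k bead with maya-true bead
    ... | suc a , 1≤a , beadAt ba with row p (suc (suc a)) <? row p (suc a)
    ...   | no ≮ = true-maya n<L (s≤s z≤n) (beadAt (begin
      k * ℓ + suc (suc a)     ≡⟨ +-suc (k * ℓ) (suc a) ⟩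
      suc (k * ℓ) + suc a     ≡⟨ ba ⟩
      row p (suc a) + offset M       ≡⟨ cong (_+ offset M) (≤-antisym (row-step P a) (≮⇒≥ ≮)) ⟨
      row p (suc (suc a)) + offset M ∎))
      where open ≡-Reasoning
    ...   | yes lt with row p (suc a) in eq
    ...     | suc r = ⊥-elim (none (suc a) (<⇒<ᵇ≡true (subst (row p (suc (suc a)) <_) (sym eq) lt)
                , subst (λ s → res ℓ (suc a) s ≡ i) (sym eq) (level⇒residue {M = M} k (suc-injective ba))))

  -- Hooks between boxes of equal residue, and separation of signs

  ℓ∤ : ∀ {n} → 0 < n → n < ℓ → ¬ ℓ ∣ n
  ℓ∤ 0<n n<ℓ ℓ∣n = <⇒≱ n<ℓ (∣⇒≤ ⦃ >-nonZero 0<n ⦄ ℓ∣n)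

  -- Going from (a + n , b) to (a , b + v) raises column minus row by v + n.
  res-along-diagonal : ∀ a b v n → res ℓ a (b + v) ≡ res ℓ (a + n) b → ℓ ∣ v + n
  res-along-diagonal a b v n eq = %≡⇒∣ (b + l * (a + n)) (shuffle a b v n l)
    (trans ([m+kn]%n≡m%n (b + v + l * a) n ℓ) eq)
    where
    shuffle : ∀ a b v n l → b + v + l * a + n * suc l ≡ b + l * (a + n) + (v + n)
    shuffle = solve-∀

  res-suc-column : ∀ x y → res ℓ x (suc y) ≢ res ℓ x y
  res-suc-column x y eq = ℓ∤ (s≤s z≤n) (<⇒≤ 2<ℓ) (res-along-diagonal x y 1 0
    (trans (cong (res ℓ x) (+-comm y 1)) (trans eq (cong (λ s → res ℓ s y) (sym (+-identityʳ x))))))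

  res-suc-row : ∀ x y → res ℓ x y ≢ res ℓ (suc x) y
  res-suc-row x y eq = ℓ∤ (s≤s z≤n) (<⇒≤ 2<ℓ) (res-along-diagonal x y 0 1
    (trans (cong (res ℓ x) (+-identityʳ y)) (trans eq (cong (λ s → res ℓ s y) (+-comm 1 x)))))

  addableEntry removableEntry : List ℕ → ℕ → Entry
  addableEntry   p x = plus , x , suc (row p x)
  removableEntry p x = minus , x , row p x

  -- Then no − precedes a + in the signature, so nothing cancels.
  Separated : List ℕ → Set
  Separated p = ∀ x z → Addable p x → Removable p z → ¬ removableEntry p z ⊑ addableEntry p x

  colLen-addable : IsPartition p → ∀ x → isAddable p (suc x) ≡ true → colLen p (suc (row p (suc x))) ≡ x
  colLen-addable P zero    ok = colLen-unique P (s≤s z≤n) (λ ()) ≤-refl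
  colLen-addable {p} P (suc x) ok = colLen-unique P (s≤s z≤n) (λ _ → isAddable⇒< p x ok) ≤-refl

  colLen-removable : IsPartition p → ∀ x → isRemovable p (suc x) ≡ true → colLen p (row p (suc x)) ≡ suc x
  colLen-removable P x ok = colLen-unique P (≤-trans (s≤s z≤n) lt) (λ _ → ≤-refl) lt
    where lt = <ᵇ≡true⇒< ok

  hook-removable : IsPartition p → ∀ x → isRemovable p (suc x) ≡ true → hook p (suc x) (row p (suc x)) ≡ 1
  hook-removable {p} P x ok = cong₂ (λ s t → s + t + 1) (n∸n≡0 (row p (suc x)))
    (trans (cong (_∸ suc x) (colLen-removable P x ok)) (n∸n≡0 (suc x)))

  -- If a removable box lies above an addable one of the same residue, JM makes all hooks between
  -- them in the column of the addable box divisible by ℓ; as these are N + 1 decreasing positive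
  -- numbers, the largest is at least ℓ (N + 1). Dually, with a row, in removable-below.
  removable-above : IsPartition p → JM ℓ p → ∀ z N → isRemovable p (suc z) ≡ true → isAddable p (suc z + suc N) ≡ true →
    ∀ v → row p (suc z) ≡ suc (row p (suc z + suc N)) + v →
    res ℓ (suc z) (row p (suc z)) ≡ res ℓ (suc z + suc N) (suc (row p (suc z + suc N))) → l * suc N ≤ v
  removable-above {p} P jm z N rem add v row-z same = +-cancelˡ-≤ (suc N) _ _ (begin
    ℓ * suc N                ≤⟨ divisible-descent ℓ f N divs (hook-positive p _ y) inc ⟩
    f N                      ≡⟨ cong (λ s → hook p s y) (trans (cong (suc z +_) (n∸n≡0 N)) (+-identityʳ _)) ⟩
    hook p (suc z) y         ≡⟨ hook-z ⟩
    v + suc N                ≡⟨ +-comm v (suc N) ⟩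
    suc N + v                ∎)
    where
    open ≤-Reasoning
    y : ℕ
    y = suc (row p (suc z + suc N))
    f : ℕ → ℕ
    -- The values run from the lowest box of column y, just above the addable position, up to row z
    -- + 1, so they increase.
    f m = hook p (suc z + (N ∸ m)) y
    colLen-y : colLen p y ≡ suc z + N
    colLen-y = trans (cong (λ s → colLen p (suc (row p (suc s)))) (+-suc z N))
      (colLen-addable P (suc (z + N)) (subst (λ s → isAddable p (suc s) ≡ true) (+-suc z N) add))
    hook-z : hook p (suc z) y ≡ v + suc N
    hook-z = trans (cong₂ (λ s t → s + t + 1)
        (trans (cong (_∸ y) row-z) (m+n∸m≡n y v)) (trans (cong (_∸ suc z) colLen-y) (m+n∸m≡n z N)))
      (trans (+-assoc v N 1) (cong (v +_) (+-comm N 1)))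
    in-column : ∀ m → suc z + (N ∸ m) ≤ colLen p y
    in-column m = subst (suc z + (N ∸ m) ≤_) (sym colLen-y) (+-monoʳ-≤ (suc z) (m∸n≤m N m))
    inc : ∀ m → m < N → f m < f (suc m)
    inc m m<N = subst (λ s → hook p s y < f (suc m)) (sym step)
      (hook-decreases-down P (s≤s z≤n) (subst (_≤ colLen p y) step (in-column m)))
      where
      step : suc z + (N ∸ m) ≡ suc (suc z + (N ∸ suc m))
      step = trans (cong (suc z +_) (+-∸-assoc 1 m<N)) (+-suc (suc z) _)
    y≤ : y ≤ row p (suc z)
    y≤ = subst (y ≤_) (sym row-z) (m≤m+n y v)
    divs : ∀ m → m ≤ N → ℓ ∣ f m
    -- The hook at (z + 1 , y) is divisible by equality of residues, and the removable box ending
    -- that row has hook 1. So JM forbids a hook not divisible by ℓ in the column.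
    divs m _ = decidable-stable (ℓ ∣? f m) λ ∤f → jm (suc z , y , suc z + (N ∸ m) , row p (suc z)
      , (s≤s z≤n , s≤s z≤n , y≤)
      , (s≤s z≤n , ≤-trans (s≤s z≤n) y≤ , ≤-refl)
      , (s≤s z≤n , s≤s z≤n , col⇒row P (s≤s z≤n) (in-column m))
      , subst (ℓ ∣_) (sym hook-z) (res-along-diagonal (suc z) y v (suc N) (trans (cong (res ℓ (suc z)) (sym row-z)) same))
      , (λ d → ℓ∤ (s≤s z≤n) (<⇒≤ 2<ℓ) (subst (ℓ ∣_) (hook-removable P z rem) d))
      , ∤f)

  removable-below : IsPartition p → JM ℓ p → ∀ x N → isAddable p (suc x) ≡ true → isRemovable p (suc x + suc N) ≡ true →
    ∀ V → row p (suc x) ≡ row p (suc x + suc N) + V →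
    res ℓ (suc x) (suc (row p (suc x))) ≡ res ℓ (suc x + suc N) (row p (suc x + suc N)) → l * suc V ≤ suc N
  removable-below {p} P jm x N add rem V row-x same = +-cancelˡ-≤ (suc V) _ _ (begin
    ℓ * suc V           ≤⟨ divisible-descent ℓ f V divs (hook-positive p _ (y + (V ∸ 0))) inc ⟩
    f V                 ≡⟨ cong (hook p (suc x)) (trans (cong (y +_) (n∸n≡0 V)) (+-identityʳ _)) ⟩
    hook p (suc x) y    ≡⟨ hook-x ⟩
    suc V + suc N       ∎)
    where
    open ≤-Reasoning
    y : ℕ
    y = row p (suc x + suc N)
    1≤y : 1 ≤ y
    1≤y = ≤-trans (s≤s z≤n) (<ᵇ≡true⇒< rem)
    f : ℕ → ℕ
    -- From the end of row x + 1 leftwards to column y.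
    f m = hook p (suc x) (y + (V ∸ m))
    hook-x : hook p (suc x) y ≡ suc V + suc N
    hook-x = trans (cong₂ (λ s t → s + t + 1)
        (trans (cong (_∸ y) row-x) (m+n∸m≡n y V))
        (trans (cong (_∸ suc x) (colLen-removable P (x + suc N) rem)) (m+n∸m≡n x (suc N))))
      (+-comm (V + suc N) 1)
    in-row : ∀ m → y + (V ∸ m) ≤ row p (suc x)
    in-row m = subst (y + (V ∸ m) ≤_) (sym row-x) (+-monoʳ-≤ y (m∸n≤m V m))
    inc : ∀ m → m < V → f m < f (suc m)
    inc m m<V = subst (λ s → hook p (suc x) s < f (suc m)) (sym step)
      (hook-decreases-right P (≤-trans 1≤y (m≤m+n y _)) (subst (_≤ row p (suc x)) step (in-row m)))
      where
      step : y + (V ∸ m) ≡ suc (y + (V ∸ suc m))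
      step = trans (cong (y +_) (+-∸-assoc 1 m<V)) (+-suc y _)
    y≤ : y ≤ row p (suc x)
    y≤ = subst (y ≤_) (sym row-x) (m≤m+n y V)
    divs : ∀ m → m ≤ V → ℓ ∣ f m
    -- Here the removable box of hook 1 lies in the column of the divisible hook, so JM forces
    -- divisibility along the row.
    divs m _ = decidable-stable (ℓ ∣? f m) λ ∤f → jm (suc x , y , suc x + suc N , y + (V ∸ m)
      , (s≤s z≤n , 1≤y , y≤)
      , (s≤s z≤n , ≤-trans 1≤y (m≤m+n y _) , in-row m)
      , (s≤s z≤n , 1≤y , ≤-refl)
      , subst (ℓ ∣_) (sym hook-x) (res-along-diagonal (suc x) y (suc V) (suc N)
          (trans (cong (res ℓ (suc x)) (trans (+-suc y V) (cong suc (sym row-x)))) same))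
      , ∤f
      , (λ d → ℓ∤ (s≤s z≤n) (<⇒≤ 2<ℓ) (subst (ℓ ∣_) (hook-removable P (x + suc N) rem) d)))

  -- A - preceding a + contradicts the bounds from divisible hooks. With the - above, l (N + 1) ≤ v
  -- and l v ≤ N + 1, impossible for l > 1. With the - below, l (V + 1) ≤ N + 1 and N + 1 < l (V +
  -- 1).
  JM⇒separated : IsPartition p → JM ℓ p → Separated p
  JM⇒separated {p} P jm = separated
    where
    SeparatedAt : ℕ → ℕ → Set
    SeparatedAt x z = Addable p x → Removable p z → ¬ removableEntry p z ⊑ addableEntry p x

    above : ∀ z N → SeparatedAt (suc z + suc N) (suc z)
    above z N (add , res-x) (rem , res-z) le with m≤n⇒∃[o]m+o≡n r<row-z
      where
      r<row-z : row p (suc z + suc N) < row p (suc z)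
      r<row-z rewrite +-suc z N = <-≤-trans (isAddable⇒< p (z + N) add) (row-antitone P (s≤s z≤n) (m≤m+n (suc z) N))
    ... | v , row-z = <-irrefl refl (begin-strict
      suc N           <⟨ m<m*n (suc N) (l * l) (≤-trans 1<l (m≤m*n l l)) ⟩
      suc N * (l * l) ≡⟨ trans (*-comm (suc N) (l * l)) (*-assoc l l (suc N)) ⟩
      l * (l * suc N) ≤⟨ *-monoʳ-≤ l (removable-above P jm z N rem add v (sym row-z) (trans res-z (sym res-x))) ⟩
      l * v           ≤⟨ lv≤ (⊑⇒lex (removableEntry p (suc z)) (addableEntry p (suc z + suc N)) le) ⟩
      suc N           ∎)
      where
      open ≤-Reasoning
      instance
        l≢0 : NonZero l
        l≢0 = >-nonZero (<⇒≤ 1<l)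
      r : ℕ
      r = row p (suc z + suc N)
      from-ranks : ladder ℓ (suc z) (row p (suc z)) ≤ ladder ℓ (suc z + suc N) (suc r) → l * v ≤ suc N
      from-ranks le = +-cancelʳ-≤ (suc z + l * r) _ _ (begin
        l * v + (suc z + l * r)          ≡⟨ shuffle l v (suc z) r ⟩
        suc z + l * (r + v)              ≡⟨ cong (λ s → suc z + l * (s ∸ 1)) row-z ⟩
        suc z + l * (row p (suc z) ∸ 1)  ≤⟨ le ⟩
        suc z + suc N + l * r            ≡⟨ trans (cong (_+ l * r) (+-comm (suc z) (suc N))) (+-assoc (suc N) (suc z) (l * r)) ⟩
        suc N + (suc z + l * r)          ∎)
        where
        shuffle : ∀ l v z r → l * v + (z + l * r) ≡ z + l * (r + v)
        shuffle = solve-∀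
      lv≤ : Lex (removableEntry p (suc z)) (addableEntry p (suc z + suc N)) → l * v ≤ suc N
      lv≤ (inj₁ lt)       = from-ranks (<⇒≤ lt)
      lv≤ (inj₂ (eq , _)) = from-ranks (≤-reflexive eq)

    below : ∀ x N → SeparatedAt (suc x) (suc x + suc N)
    below x N (add , res-x) (rem , res-z) le
      with m≤n⇒∃[o]m+o≡n (row-antitone {b = suc x + suc N} P (s≤s z≤n) (m≤m+n (suc x) (suc N)))
         | m≤n⇒∃[o]m+o≡n (≤-trans (s≤s z≤n) (<ᵇ≡true⇒< rem))
         | ⊑⇒lex (removableEntry p (suc x + suc N)) (addableEntry p (suc x)) le
    -- A ladder is read top to bottom, so the lower entry cannot come first.
    ... | V , row-x | Y , row-z | inj₂ (_ , le′) = m+1+n≰m (suc x) le′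
    ... | V , row-x | Y , row-z | inj₁ lt = <⇒≱ (+-cancelˡ-< (suc x + l * Y) _ _ (begin-strict
      suc x + l * Y + suc N                       ≡⟨ shuffle₁ (suc x) l Y (suc N) ⟩
      suc x + suc N + l * Y                       ≡⟨ cong (λ s → suc x + suc N + l * (s ∸ 1)) row-z ⟩
      suc x + suc N + l * (row p (suc x + suc N) ∸ 1) <⟨ lt ⟩
      suc x + l * row p (suc x)                   ≡⟨ cong (λ s → suc x + l * s) (trans (sym row-x) (cong (_+ V) (sym row-z))) ⟩
      suc x + l * (suc Y + V)                     ≡⟨ shuffle₂ (suc x) l Y V ⟩
      suc x + l * Y + l * suc V                   ∎))
        (removable-below P jm x N add rem V (sym row-x) (trans res-x (sym res-z)))
      where
      open ≤-Reasoning
      shuffle₁ : ∀ x l Y N → x + l * Y + N ≡ x + N + l * Y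
      shuffle₁ = solve-∀
      shuffle₂ : ∀ x l Y V → x + l * (suc Y + V) ≡ x + l * Y + l * suc V
      shuffle₂ = solve-∀

    separated : Separated p
    separated zero    z       (() , _)
    separated (suc x) zero    _        (() , _)
    separated (suc x) (suc z) add rem with <-cmp z x
    ... | tri≈ _ refl _ = λ _ → res-suc-column (suc x) (row p (suc x)) (trans (proj₂ add) (sym (proj₂ rem)))
    ... | tri< z<x _ _ with N , eq ← m≤n⇒∃[o]m+o≡n z<x =
      subst (λ s → SeparatedAt s (suc z)) (trans (+-suc (suc z) N) (cong suc eq)) (above z N) add rem
    ... | tri> _ _ x<z with N , eq ← m≤n⇒∃[o]m+o≡n x<z =
      subst (SeparatedAt (suc x)) (trans (+-suc (suc x) N) (cong suc eq)) (below x N) add rem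

  -- Signatures of separated partitions and the crystal operators

  ∈signature⁻ : ∀ {e} → e ∈ signature ℓ i p →
    (∃ λ x → Addable p x × e ≡ addableEntry p x) ⊎ (∃ λ x → Removable p x × e ≡ removableEntry p x)
  ∈signature⁻ {p} e∈ with ∈-++⁻ (addables ℓ i p) (∈-resp-↭ (sortEntries-↭ (addables ℓ i p ++ removables ℓ i p)) e∈)
  ... | inj₁ e∈a with x , ok , eq ← mapMaybe-if⁻ (λ x → isAddable p x ∧ (res ℓ x (suc (row p x)) ≡ᵇ i)) (addableEntry p) (rows1 p) e∈a =
    inj₁ (x , (∧-conicalˡ _ _ ok , ≡ᵇ≡true⇒≡ (∧-conicalʳ (isAddable p x) _ ok)) , eq)
  ... | inj₂ e∈r with x , ok , eq ← mapMaybe-if⁻ (λ x → isRemovable p x ∧ (res ℓ x (row p x) ≡ᵇ i)) (removableEntry p) (rows1 p) e∈r =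
    inj₂ (x , (∧-conicalˡ _ _ ok , ≡ᵇ≡true⇒≡ (∧-conicalʳ (isRemovable p x) _ ok)) , eq)

  ∈rows1 : ∀ {x} → x ≤ length p → suc x ∈ rows1 p
  ∈rows1 x≤n = ∈-map⁺ suc (∈-upTo⁺ (s≤s x≤n))

  addable∈signature : ∀ x → Addable p x → addableEntry p x ∈ signature ℓ i p
  addable∈signature {p} (suc x) (ok , res≡) = ∈-resp-↭ (↭-sym (sortEntries-↭ _)) (∈-++⁺ˡ
    (mapMaybe-if⁺ (λ x → isAddable p x ∧ (res ℓ x (suc (row p x)) ≡ᵇ i)) (addableEntry p) (rows1 p)
      (∈rows1 {p} (isAddable⇒≤length p x ok)) (cong₂ _∧_ ok (≡⇒≡ᵇ≡true res≡))))

  removable∈signature : ∀ x → Removable p x → removableEntry p x ∈ signature ℓ i p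
  removable∈signature {p} (suc x) (ok , res≡) = ∈-resp-↭ (↭-sym (sortEntries-↭ _)) (∈-++⁺ʳ (addables ℓ i p)
    (mapMaybe-if⁺ (λ x → isRemovable p x ∧ (res ℓ x (row p x) ≡ᵇ i)) (removableEntry p) (rows1 p)
      (∈rows1 {p} (<⇒≤ (isRemovable⇒≤length p x ok))) (cong₂ _∧_ ok (≡⇒≡ᵇ≡true res≡))))

  signature-sorted : AllPairs _⊑_ (signature ℓ i p)
  signature-sorted {p} = sortEntries-sorted (addables ℓ i p ++ removables ℓ i p)

  reduced≡signature : Separated p → reduced ℓ i p ≡ signature ℓ i p
  reduced≡signature {p} sep = cancelAux-¬cancels [] (signature ℓ i p) (λ ()) (AllPairs-map ordered (signature-sorted {p}))
    where
    ordered : ∀ {d e} → d ∈ signature ℓ i p → e ∈ signature ℓ i p → d ⊑ e → ¬ Cancels d e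
    ordered d∈ e∈ d⊑e cancels with ∈signature⁻ {p} d∈ | ∈signature⁻ {p} e∈
    ... | inj₂ (z , rem , refl) | inj₁ (x , add , refl) = sep x z add rem d⊑e
    ... | inj₁ (_ , _ , ())     | _
    ... | inj₂ _                | inj₂ (_ , _ , ())

  -- Nothing cancels, so the chosen + is the last of all +'s; dually `eHat-spec` picks the first of
  -- all -'s. These extremal positions keep the partition separated after the step.
  fHat-spec : Separated p →
    (fHat ℓ i (just p) ≡ nothing × (∀ x → ¬ Addable p x)) ⊎
    (∃ λ x → fHat ℓ i (just p) ≡ just (addBox x p) × Addable p x ×
      (∀ z → Addable p z → z ≢ x → ¬ addableEntry p x ⊑ addableEntry p z))
  fHat-spec {p} sep rewrite reduced≡signature {p} sep
    with firstPlus-spec (AllPairs-reverse (signature-sorted {p}))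
  ... | inj₁ (eq , none) rewrite eq = inj₁ (refl , λ x add →
          none (∈-resp-↭ (↭-sym (↭-reverse _)) (addable∈signature {p} x add)))
  ... | inj₂ (x , y , eq , x∈ , last) rewrite eq with ∈signature⁻ {p} (∈-resp-↭ (↭-reverse _) x∈)
  ...   | inj₂ (_ , _ , ())
  ...   | inj₁ (_ , add , refl) = inj₂ (x , refl , add , latest)
    where
    latest : ∀ z → Addable p z → z ≢ x → ¬ addableEntry p x ⊑ addableEntry p z
    latest z addz z≢x x⊑z with last (∈-resp-↭ (↭-sym (↭-reverse _)) (addable∈signature {p} z addz))
    ... | inj₁ refl = z≢x refl
    ... | inj₂ z⊑x = z≢x (⊑-antisym {addableEntry p z} {addableEntry p x} z⊑x x⊑z)

  eHat-spec : Separated p →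
    (eHat ℓ i (just p) ≡ nothing × (∀ x → ¬ Removable p x)) ⊎
    (∃ λ x → eHat ℓ i (just p) ≡ just (removeBox x p) × Removable p x ×
      (∀ z → Removable p z → z ≢ x → ¬ removableEntry p z ⊑ removableEntry p x))
  eHat-spec {p} sep rewrite reduced≡signature {p} sep with firstMinus-spec (signature-sorted {p})
  ... | inj₁ (eq , none) rewrite eq = inj₁ (refl , λ x rem → none (removable∈signature {p} x rem))
  ... | inj₂ (x , y , eq , x∈ , first) rewrite eq with ∈signature⁻ {p} x∈
  ...   | inj₁ (_ , _ , ())
  ...   | inj₂ (_ , rem , refl) = inj₂ (x , refl , rem , earliest)
    where
    earliest : ∀ z → Removable p z → z ≢ x → ¬ removableEntry p z ⊑ removableEntry p x
    earliest z remz z≢x z⊑x with first (removable∈signature {p} z remz)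
    ... | inj₁ refl = z≢x refl
    ... | inj₂ x⊑z = z≢x (⊑-antisym {removableEntry p z} {removableEntry p x} z⊑x x⊑z)

  -- Signs before and after adding one box

  module _ {p p⁺ : List ℕ} {x : ℕ} (P : IsPartition p) (P⁺ : IsPartition p⁺)
           (adds : AddsBox p p⁺ x) (res≡i : res ℓ x (suc (row p x)) ≡ i) where
    open AddsBox adds

    row-grows : ∀ z → 1 ≤ z → row p z ≤ row p⁺ z
    row-grows z 1≤z with z ≟ x
    ... | yes refl = subst (row p z ≤_) (sym at) (n≤1+n _)
    ... | no z≢x   = ≤-reflexive (sym (beside 1≤z z≢x))

    x-not-addable : ¬ Addable p⁺ x
    x-not-addable (_ , eq) = res-suc-column x (suc (row p x))
      (trans (subst (λ r → res ℓ x (suc r) ≡ i) at eq) (sym res≡i))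

    x-not-removable : ¬ Removable p x
    x-not-removable (_ , eq) = res-suc-column x (row p x) (trans res≡i (sym eq))

    -- The only positions that the new box could make addable are to its right and below it, and
    -- their residues differ from i.
    addable-old : ∀ z → Addable p⁺ z → z ≢ x × row p⁺ z ≡ row p z × Addable p z
    addable-old (suc z) add@(ok , res-z) = z≢x , row≡ , ok′ z ok row≡ res-z z≢x , subst (λ r → res ℓ (suc z) (suc r) ≡ i) row≡ res-z
      where
      z≢x : suc z ≢ x
      z≢x refl = x-not-addable add
      row≡ : row p⁺ (suc z) ≡ row p (suc z)
      row≡ = beside (s≤s z≤n) z≢x
      ok′ : ∀ z → isAddable p⁺ (suc z) ≡ true → row p⁺ (suc z) ≡ row p (suc z) → res ℓ (suc z) (suc (row p⁺ (suc z))) ≡ i →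
            suc z ≢ x → isAddable p (suc z) ≡ true
      ok′ zero    _  _    _     _   = refl
      ok′ (suc z) ok row≡ res-z z≢x with suc z ≟ x
      ... | no z′≢x = <⇒<ᵇ≡true (subst₂ _<_ row≡ (beside (s≤s z≤n) z′≢x) (isAddable⇒< p⁺ z ok))
      ... | yes refl = <⇒<ᵇ≡true (≤∧≢⇒< (≤-pred (subst₂ _<_ row≡ at (isAddable⇒< p⁺ z ok))) λ eq →
              res-suc-row (suc z) (suc (row p (suc z))) (trans res≡i (trans (sym res-z)
                (cong (λ r → res ℓ (suc (suc z)) (suc r)) (trans row≡ eq)))))

    addable-new : ∀ z → Addable p z → z ≢ x → row p⁺ z ≡ row p z × Addable p⁺ z
    addable-new (suc z) (ok , res-z) z≢x = row≡ , ok′ z ok row≡ , subst (λ r → res ℓ (suc z) (suc r) ≡ i) (sym row≡) res-z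
      where
      row≡ : row p⁺ (suc z) ≡ row p (suc z)
      row≡ = beside (s≤s z≤n) z≢x
      ok′ : ∀ z → isAddable p (suc z) ≡ true → row p⁺ (suc z) ≡ row p (suc z) → isAddable p⁺ (suc z) ≡ true
      ok′ zero    _  _    = refl
      ok′ (suc z) ok row≡ = <⇒<ᵇ≡true (subst (_< row p⁺ (suc z)) (sym row≡)
        (<-≤-trans (isAddable⇒< p z ok) (row-grows (suc z) (s≤s z≤n))))

    removable-old : ∀ z → Removable p⁺ z → z ≢ x → row p⁺ z ≡ row p z × Removable p z
    removable-old (suc z) (ok , res-z) z≢x = row≡ ,
      <⇒<ᵇ≡true (subst (row p (suc (suc z)) <_) row≡ (≤-<-trans (row-grows (suc (suc z)) (s≤s z≤n)) (<ᵇ≡true⇒< ok))) ,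
      subst (λ r → res ℓ (suc z) r ≡ i) row≡ res-z
      where
      row≡ : row p⁺ (suc z) ≡ row p (suc z)
      row≡ = beside (s≤s z≤n) z≢x

    -- The new box could block only its left and upper neighbours, whose residues differ from i.
    removable-new : ∀ z → Removable p z → z ≢ x × row p⁺ z ≡ row p z × Removable p⁺ z
    removable-new (suc z) rem@(ok , res-z) = z≢x , row≡ , still , subst (λ r → res ℓ (suc z) r ≡ i) (sym row≡) res-z
      where
      z≢x : suc z ≢ x
      z≢x refl = x-not-removable rem
      row≡ : row p⁺ (suc z) ≡ row p (suc z)
      row≡ = beside (s≤s z≤n) z≢x
      still : isRemovable p⁺ (suc z) ≡ true
      still with suc (suc z) ≟ x
      ... | no z′≢x = <⇒<ᵇ≡true (subst₂ _<_ (sym (beside (s≤s z≤n) z′≢x)) (sym row≡) (<ᵇ≡true⇒< ok))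
      ... | yes refl = <⇒<ᵇ≡true (subst₂ _<_ (sym at) (sym row≡) (≤∧≢⇒< (<ᵇ≡true⇒< ok) λ eq →
              res-suc-row (suc z) (row p (suc z)) (trans res-z (trans (sym res≡i) (cong (res ℓ (suc (suc z))) eq)))))

    -- The only new - stands where the last + was, hence after every remaining +.
    separated-add : (∀ z → Addable p z → z ≢ x → ¬ addableEntry p x ⊑ addableEntry p z) →
      Separated p → Separated p⁺
    separated-add latest sep y z addy remz with addable-old y addy | z ≟ x
    ... | y≢x , row-y , addy′ | yes refl rewrite row-y | at = latest y addy′ y≢x
    ... | y≢x , row-y , addy′ | no z≢x with row-z , remz′ ← removable-old z remz z≢x
      rewrite row-y | row-z = sep y z addy′ remz′

    -- The only new + stands where the first - was, hence before every remaining -.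
    separated-remove : (∀ z → Removable p⁺ z → z ≢ x → ¬ removableEntry p⁺ z ⊑ removableEntry p⁺ x) →
      Separated p⁺ → Separated p
    separated-remove earliest sep y z addy remz with removable-new z remz | y ≟ x
    ... | z≢x , row-z , remz′ | yes refl =
      subst₂ (λ r s → ¬ (minus , z , r) ⊑ (plus , y , s)) row-z at (earliest z remz′ z≢x)
    ... | z≢x , row-z , remz′ | no y≢x with row-y , addy′ ← addable-new y addy y≢x =
      subst₂ (λ r s → ¬ (minus , z , r) ⊑ (plus , y , suc s)) row-z row-y (sep y z addy′ remz′)

  -- Steps and strings

  record Grows (p p⁺ : List ℕ) : Set where
    field
      length-≤ : length p ≤ length p⁺
      flips    : ∀ M → length p⁺ < offset M → ∃ λ k → Flip ℓ (abacus (offset M) p) (abacus (offset M) p⁺) k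

  -- The invariant of a string: separation passes through every step, whereas the JM condition may
  -- fail in between.
  Good : List ℕ → Set
  Good p = IsPartition p × Separated p

  fHat-step : Good p →
    (fHat ℓ i (just p) ≡ nothing × (∀ x → ¬ Addable p x)) ⊎
    (∃ λ p⁺ → fHat ℓ i (just p) ≡ just p⁺ × Good p⁺ × Grows p p⁺)
  fHat-step {p} (P , sep) with fHat-spec {p} sep
  ... | inj₁ stop = inj₁ stop
  ... | inj₂ (suc x , eq , (ok , res≡) , latest) = inj₂ (addBox (suc x) p , eq ,
          (P⁺ , separated-add P P⁺ adds res≡ latest sep) , record
            { length-≤ = length-addBox (suc x) p
            ; flips = λ M n<L → addsBox⇒flip M P P⁺ (≤-<-trans (length-addBox (suc x) p) n<L) n<L adds res≡ })
    where
    adds : AddsBox p (addBox (suc x) p) (suc x)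
    adds = addBox-addsBox p x (isAddable⇒≤length p x ok)
    P⁺ : IsPartition (addBox (suc x) p)
    P⁺ = addBox-partition p x P ok

  eHat-step : Good p →
    (eHat ℓ i (just p) ≡ nothing × (∀ x → ¬ Removable p x)) ⊎
    (∃ λ p⁻ → eHat ℓ i (just p) ≡ just p⁻ × Good p⁻ × Grows p⁻ p)
  eHat-step {p} (P , sep) with eHat-spec {p} sep
  ... | inj₁ stop = inj₁ stop
  ... | inj₂ (suc x , eq , (ok , res≡) , earliest) = inj₂ (removeBox (suc x) p , eq ,
          (P⁻ , separated-remove P⁻ P adds res≡′ earliest sep) , record
            { length-≤ = length-removeBox (suc x) p
            ; flips = λ M n<L → addsBox⇒flip M P⁻ P (≤-<-trans (length-removeBox (suc x) p) n<L) n<L adds res≡′ })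
    where
    adds : AddsBox (removeBox (suc x) p) p (suc x)
    adds = removeBox-addsBox p x (proj₁ P) (<ᵇ≡true⇒< ok)
    P⁻ : IsPartition (removeBox (suc x) p)
    P⁻ = removeBox-partition p x P ok
    res≡′ : res ℓ (suc x) (suc (row (removeBox (suc x) p) (suc x))) ≡ i
    res≡′ = trans (cong (res ℓ (suc x)) (sym (AddsBox.at adds))) res≡

  <offset : ∀ M → M < offset M
  <offset M = ≤-<-trans (m≤n*m M ℓ) (m<m+n (ℓ * M) (s≤s z≤n))

  -- The offset stays free, so that partitions of different lengths can be compared on one abacus
  -- large enough for all of them.
  record Connected (p p⁺ : List ℕ) : Set where
    field
      length-≤ : length p ≤ length p⁺
      related  : ∀ M → length p⁺ < offset M → Related ℓ (abacus (offset M) p) (abacus (offset M) p⁺)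

  connected-refl : Connected p p
  connected-refl = record { length-≤ = ≤-refl ; related = λ _ _ → identical }

  connected-step-up : Connected p μ → Grows μ p⁺ → Connected p p⁺
  connected-step-up C G = record
    { length-≤ = ≤-trans C.length-≤ G.length-≤
    ; related  = λ M n<L → related-trans (C.related M (≤-<-trans G.length-≤ n<L)) (flip⇒related 2<ℓ (proj₂ (G.flips M n<L)))
    }
    where
    module C = Connected C
    module G = Grows G

  connected-step-down : Grows p μ → Connected μ p⁺ → Connected p p⁺
  connected-step-down G C = record
    { length-≤ = ≤-trans G.length-≤ C.length-≤
    ; related  = λ M n<L → related-trans (flip⇒related 2<ℓ (proj₂ (G.flips M (≤-<-trans C.length-≤ n<L)))) (C.related M n<L)
    }
    where
    module C = Connected C
    module G = Grows G

  grows²-not-JM : ∀ {ν μ μ′ μ″} → IsPartition μ → Grows ν μ → Grows μ μ′ → Grows μ′ μ″ → ¬ JM ℓ μ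
  grows²-not-JM {ν} {μ} {μ′} {μ″} P G G′ G″ jm = JM⇒¬violation P μ<L jm
    (three-flips⇒violation 2<ℓ (proj₂ (Grows.flips G M μ<L)) (proj₂ (Grows.flips G′ M μ′<L)) (proj₂ (Grows.flips G″ M μ″<L)))
    where
    M : ℕ
    M = length μ″
    μ″<L : length μ″ < offset M
    μ″<L = <offset M
    μ′<L : length μ′ < offset M
    μ′<L = ≤-<-trans (Grows.length-≤ G″) μ″<L
    μ<L : length μ < offset M
    μ<L = ≤-<-trans (Grows.length-≤ G′) μ′<L

  -- With no + left, runner 1 contains runner 0, and `reflect-violation` would carry a violation
  -- back to p; `no-removable⇒JM` exchanges the two runners.
  no-addable⇒JM : IsPartition p → JM ℓ p → IsPartition μ → Connected p μ → (∀ x → ¬ Addable μ x) → JM ℓ μ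
  no-addable⇒JM {p} {μ} P jm Pμ C none = ¬violation⇒JM Pμ μ<L λ v → JM⇒¬violation P p<L jm
    (reflect-violation 2<ℓ (Connected.related C (length μ) μ<L) false (no-addable⇒terminal (length μ) Pμ μ<L none) v)
    where
    μ<L : length μ < offset (length μ)
    μ<L = <offset (length μ)
    p<L : length p < offset (length μ)
    p<L = ≤-<-trans (Connected.length-≤ C) μ<L

  no-removable⇒JM : IsPartition p → JM ℓ p → IsPartition μ → Connected μ p → (∀ x → ¬ Removable μ x) → JM ℓ μ
  no-removable⇒JM {p} {μ} P jm Pμ C none = ¬violation⇒JM Pμ μ<L λ v → JM⇒¬violation P p<L jm
    (reflect-violation 2<ℓ (related-sym (Connected.related C (length p) p<L)) true (no-removable⇒terminal (length p) Pμ μ<L none) v)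
    where
    p<L : length p < offset (length p)
    p<L = <offset (length p)
    μ<L : length μ < offset (length p)
    μ<L = ≤-<-trans (Connected.length-≤ C) p<L

  module F = Iterates (fHat ℓ i) refl
  module E = Iterates (eHat ℓ i) refl

  fHat-good : ∀ {ν} → Good μ → fHat ℓ i (just μ) ≡ just ν → Good ν × Grows μ ν
  fHat-good good eq with fHat-step good
  ... | inj₁ (stop , _) with () ← trans (sym eq) stop
  ... | inj₂ (_ , eq′ , good′ , grows) with refl ← just-injective (trans (sym eq′) eq) = good′ , grows

  eHat-good : ∀ {ν} → Good μ → eHat ℓ i (just μ) ≡ just ν → Good ν × Grows ν μ
  eHat-good good eq with eHat-step good
  ... | inj₁ (stop , _) with () ← trans (sym eq) stop
  ... | inj₂ (_ , eq′ , good′ , grows) with refl ← just-injective (trans (sym eq′) eq) = good′ , grows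

  iter-fHat-good : Good p → ∀ k → iter k (fHat ℓ i) (just p) ≡ just μ → Good μ × Connected p μ
  iter-fHat-good good zero    refl = good , connected-refl
  iter-fHat-good good (suc k) eq
    with ν , eqν , step ← F.iter-pred k eq
    with goodν , conn ← iter-fHat-good good k eqν
    with goodμ , grows ← fHat-good goodν step = goodμ , connected-step-up conn grows

  iter-eHat-good : Good p → ∀ k → iter k (eHat ℓ i) (just p) ≡ just μ → Good μ × Connected μ p
  iter-eHat-good good zero    refl = good , connected-refl
  iter-eHat-good good (suc k) eq
    with ν , eqν , step ← E.iter-pred k eq
    with goodν , conn ← iter-eHat-good good k eqν
    with goodμ , grows ← eHat-good goodν step = goodμ , connected-step-down grows conn

  -- Ends and interior of the strings of a JM partition

  module _ (P : IsPartition p) (jm : JM ℓ p) where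

    private
      good : Good p
      good = P , JM⇒separated P jm

    fHat-max-JM : ∀ {φ} → IsMaxNonzero (fHat ℓ i) p φ → ∃ λ μ → iter φ (fHat ℓ i) (just p) ≡ just μ × JM ℓ μ
    fHat-max-JM {φ} max
      with μ , eq ← F.iter-defined {k = φ} ≤′-refl (proj₁ max)
      with goodμ , conn ← iter-fHat-good good φ eq
      with fHat-step goodμ
    ... | inj₁ (_ , none)   = μ , eq , no-addable⇒JM P jm (proj₁ goodμ) conn none
    ... | inj₂ (_ , eq′ , _) = ⊥-elim (F.stops-at-max {n = φ} max eq eq′)

    eHat-max-JM : ∀ {ε} → IsMaxNonzero (eHat ℓ i) p ε → ∃ λ μ → iter ε (eHat ℓ i) (just p) ≡ just μ × JM ℓ μ
    eHat-max-JM {ε} max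
      with μ , eq ← E.iter-defined {k = ε} ≤′-refl (proj₁ max)
      with goodμ , conn ← iter-eHat-good good ε eq
      with eHat-step goodμ
    ... | inj₁ (_ , none)   = μ , eq , no-removable⇒JM P jm (proj₁ goodμ) conn none
    ... | inj₂ (_ , eq′ , _) = ⊥-elim (E.stops-at-max {n = ε} max eq eq′)

    fHat-middle-not-JM : ∀ {n} k → ¬ iter n (fHat ℓ i) (just p) ≡ nothing → suc (suc (suc k)) ≤ n →
      iter (suc k) (fHat ℓ i) (just p) ≡ just μ → ¬ JM ℓ μ
    fHat-middle-not-JM k ≢nothing k+3≤n eq
      with ν , eqν , step₀ ← F.iter-pred k eq
      with μ′ , step₁ ← F.next {k = suc k} (<⇒≤ k+3≤n) ≢nothing eq
      with μ″ , step₂ ← F.next {k = suc (suc k)} k+3≤n ≢nothing (trans (cong (fHat ℓ i) eq) step₁)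
      with goodν , _ ← iter-fHat-good good k eqν
      with goodμ , G ← fHat-good goodν step₀
      with goodμ′ , G′ ← fHat-good goodμ step₁
      with _ , G″ ← fHat-good goodμ′ step₂ = grows²-not-JM (proj₁ goodμ) G G′ G″

    eHat-middle-not-JM : ∀ {n} k → ¬ iter n (eHat ℓ i) (just p) ≡ nothing → suc (suc (suc k)) ≤ n →
      iter (suc (suc k)) (eHat ℓ i) (just p) ≡ just μ → ¬ JM ℓ μ
    eHat-middle-not-JM k ≢nothing k+3≤n eq
      with ν , eqν , step₁ ← E.iter-pred (suc k) eq
      with κ , eqκ , step₀ ← E.iter-pred k eqν
      with μ′ , step₂ ← E.next {k = suc (suc k)} k+3≤n ≢nothing eq
      with goodκ , _ ← iter-eHat-good good k eqκ
      with goodν , G ← eHat-good goodκ step₀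
      with goodμ , G′ ← eHat-good goodν step₁
      -- In the direction of growth the steps of the operator come in reverse order: one below μ and
      -- two above.
      with _ , G″ ← eHat-good goodμ step₂ = grows²-not-JM (proj₁ goodμ) G″ G′ G

theorem4p7 : (ℓ : ℕ) → 2 < ℓ → (p : List ℕ) → IsPartition p → JM ℓ p →
    (i : ℕ) → i < ℓ → (φ ε : ℕ) →
    IsMaxNonzero (fHat ℓ i) p φ → IsMaxNonzero (eHat ℓ i) p ε →
    (∃ λ μ → iter φ (fHat ℓ i) (just p) ≡ just μ × JM ℓ μ) ×
    (∃ λ μ → iter ε (eHat ℓ i) (just p) ≡ just μ × JM ℓ μ) ×
    (∀ k → 0 < k → k < φ ∸ 1 → ∀ μ → iter k (fHat ℓ i) (just p) ≡ just μ → ¬ JM ℓ μ) ×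
    (∀ k → 1 < k → k < ε → ∀ μ → iter k (eHat ℓ i) (just p) ≡ just μ → ¬ JM ℓ μ)
theorem4p7 (suc l) (s≤s 1<l) p P jm i i<ℓ φ ε maxφ maxε =
  fHat-max-JM P jm maxφ , eHat-max-JM P jm maxε ,
  (λ { (suc k) _ k<φ∸1 μ eq → fHat-middle-not-JM P jm k (proj₁ maxφ) (m<n∸1⇒1+m<n φ k<φ∸1) eq }) ,
  (λ { (suc (suc k)) _ k<ε μ eq → eHat-middle-not-JM P jm k (proj₁ maxε) k<ε eq ; (suc zero) (s≤s ()) })
  where
  open LadderCrystal l 1<l i i<ℓ
  -- No clause for n = 0: the truncated `0 ∸ 1` is 0, and no m is below it.
  m<n∸1⇒1+m<n : ∀ {m} n → m < n ∸ 1 → suc m < n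
  m<n∸1⇒1+m<n (suc n) m<n = s≤s m<n
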